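{- Let $\mathbf m=\{\hat0=\pi_0\prec\pi_1\prec\cdots\prec\pi_k=\hat1\}$ be a maximal chain in $\mathrm{NC}^d_{dk+1}$ and let $T$ be the $d$-parking tree with $\lambda(\mathbf m)=\vec a(T)$. Identify each vertex $v$ of $T$ with the element $\omega(v)\in[dk+1]$, where $\omega$ is the depth-first search ordering of $T$. Then for each $0\le i\le k$, $\pi_i$ is the partition of $[dk+1]$ whose blocks are the vertex sets of the connected components of the graph on the vertices of $T$ containing exactly those edges of $T$ that connect a vertex $j_s$ to its parent, for $1\le j\le i$ and $1\le s\le d$. In particular, $\pi_i$ is obtained from $\pi_{i-1}$ by merging the blocks containing the $d+1$ elements $\omega(p_i),\omega(i_1),\dots,\omega(i_d)$, where $p_i$ is the common parent of $i_1,\dots,i_d$.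
   Context: A partition of $[n]$ is noncrossing if there are no $i<j<k<\ell$ with $i,k$ in one block and $j,\ell$ in a different block. The Kreweras dual $\pi'$ of a noncrossing partition $\pi$ of $[n]$: place $1,1',\dots,n,n'$ on a circle in this cyclic order; $\pi'$ is the coarsest partition of $\{1',\dots,n'\}$ such that the blocks of $\pi$ and of $\pi'$ together form a noncrossing partition of these $2n$ points. $\mathrm{NC}^d_n$ is the poset, ordered by refinement, of noncrossing partitions $\pi$ of $[n]$ such that every block of $\pi$ and of $\pi'$ has cardinality $\equiv1\bmod d$. Every cover $\pi\prec\sigma$ merges $d+1$ blocks $B_1,\dots,B_{d+1}$ of $\pi$ with $\min B_1<\cdots<\min B_{d+1}$, and $\lambda(\pi,\sigma)=\max\{i\in B_1:i<\min B_2\}$; $\lambda(\mathbf m)$ is the list of labels along $\mathbf m$. A $d$-parking tree is a rooted plane tree on $dk+1$ vertices in which each vertex has a multiple of $d$ children, with labels: root $\infty$; other vertices labeled $i_j$ ($1\le i\le k$, $1\le j\le d$), each label used once; $i_1,\dots,i_d$ are consecutive siblings in this left-to-right order; if $i_j,i'_{j'}$ are siblings with $i<i'$ then $i_j$ is to the right of $i'_{j'}$. The depth-first search ordering $\omega$ is the preorder numbering by $1,\dots,dk+1$ (root first, then the subtrees of the children from left to right recursively). $\vec a(T)=(a_1,\dots,a_k)$ where $a_i=\omega(\text{common parent of }i_1,\dots,i_d)$; the map $T\mapsto\vec a(T)$ is a bijection onto $d$-parking functions, and $\lambda(\mathbf m)$ is a $d$-parking function, so $T$ is well defined. -}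

module Defs where

open import Data.Nat using (ℕ; zero; suc; _+_; _*_; _≤_; _<_; _≟_)
open import Data.Fin using (Fin; toℕ; fromℕ; inject₁) renaming (zero to fzero; suc to fsuc)
open import Data.List using (List; []; _∷_; _++_; length; map; filter; lookup; allFin)
open import Data.List.Membership.Propositional using (_∈_)
open import Data.List.Relation.Unary.Unique.Propositional using (Unique)
open import Data.List.Relation.Unary.All using (All)
open import Data.Product using (Σ; ∃; _×_; _,_; proj₁; proj₂)
open import Data.Sum using (_⊎_)
open import Data.Bool using (Bool; true; false)
open import Data.Unit using (⊤)
open import Data.Empty using (⊥)
open import Relation.Nullary using (¬_)
open import Relation.Binary.PropositionalEquality using (_≡_)
open import Relation.Binary.Construct.Closure.Equivalence using (EqClosure)

-- Set partitions of [n] = {1,…,n}.  Element x : Fin n stands for the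
-- integer toℕ x + 1.  A partition is given by a block-labelling
-- function; x and y lie in the same block iff they get the same label.

Partition : ℕ → Set
Partition n = Fin n → ℕ

SameBlock : ∀ {n} → Partition n → Fin n → Fin n → Set
SameBlock π x y = π x ≡ π y

_≤ₚ_ : ∀ {n} → Partition n → Partition n → Set
π ≤ₚ σ = ∀ x y → SameBlock π x y → SameBlock σ x y

blockSize : ∀ {n} → Partition n → Fin n → ℕ
blockSize {n} π x = length (filter (λ y → π x ≟ π y) (allFin n))

-- m ≡ 1 (mod d)   (block sizes are ≥ 1)
OneModD : ℕ → ℕ → Set
OneModD d m = ∃ λ q → m ≡ 1 + q * d

AllBlocksOneMod : ∀ {n} → ℕ → Partition n → Set
AllBlocksOneMod d π = ∀ x → OneModD d (blockSize π x)

NonCrossingOn : {A : Set} → (A → ℕ) → (A → A → Set) → Set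
NonCrossingOn pos R =
  ∀ a b c e → pos a < pos b → pos b < pos c → pos c < pos e →
  ¬ (R a c × R b e × ¬ R a b)

NonCrossing : ∀ {n} → Partition n → Set
NonCrossing π = NonCrossingOn toℕ (SameBlock π)

-- the 2n points 1,1',2,2',…,n,n' on a circle, in this cyclic order:
-- (i , false) is i, (i , true) is i'.
circPos : ∀ {n} → Fin n × Bool → ℕ
circPos (i , false) = 2 * toℕ i
circPos (i , true)  = 2 * toℕ i + 1

Joint : ∀ {n} → Partition n → Partition n → Fin n × Bool → Fin n × Bool → Set
Joint π ρ (i , false) (j , false) = SameBlock π i j
Joint π ρ (i , true)  (j , true)  = SameBlock ρ i j
Joint π ρ (i , false) (j , true)  = ⊥
Joint π ρ (i , true)  (j , false) = ⊥

IsKreweras : ∀ {n} → Partition n → Partition n → Set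
IsKreweras π ρ =
  NonCrossingOn circPos (Joint π ρ) ×
  (∀ σ → NonCrossingOn circPos (Joint π σ) → σ ≤ₚ ρ)

InNCd : ∀ {n} → ℕ → Partition n → Set
InNCd d π =
  NonCrossing π ×
  Σ _ λ ρ → IsKreweras π ρ × AllBlocksOneMod d π × AllBlocksOneMod d ρ

CoverNCd : ∀ {n} → ℕ → Partition n → Partition n → Set
CoverNCd d π σ =
  InNCd d π × InNCd d σ × π ≤ₚ σ × ¬ (σ ≤ₚ π) ×
  (∀ τ → InNCd d τ → ¬ (π ≤ₚ τ × ¬ (τ ≤ₚ π) × τ ≤ₚ σ × ¬ (σ ≤ₚ τ)))

IsBottom : ∀ {n} → Partition n → Set
IsBottom π = ∀ x y → SameBlock π x y → x ≡ y

IsTop : ∀ {n} → Partition n → Set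
IsTop π = ∀ x y → SameBlock π x y

MaximalChainNCd : (d k : ℕ) → (Fin (suc k) → Partition (suc (d * k))) → Set
MaximalChainNCd d k π =
  (∀ i → InNCd d (π i)) ×
  IsBottom (π fzero) × IsTop (π (fromℕ k)) ×
  (∀ (i : Fin k) → CoverNCd d (π (inject₁ i)) (π (fsuc i)))

-- Edge label λ(π,σ) of a cover.  The elements whose block changes are
-- exactly those of the merged blocks B₁,…,B_{d+1}; m₁ = min B₁ is the
-- least changed element, m₂ = min B₂ is the least changed element not
-- in B₁, and λ = max{ i ∈ B₁ : i < min B₂ } (as an integer in [n]).

Changed : ∀ {n} → Partition n → Partition n → Fin n → Set
Changed π σ x = ∃ λ y → SameBlock σ x y × ¬ SameBlock π x y

IsLabel : ∀ {n} → Partition n → Partition n → ℕ → Set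
IsLabel {n} π σ ℓ =
  Σ (Fin n) λ m₁ → Σ (Fin n) λ m₂ → Σ (Fin n) λ x →
    (Changed π σ m₁ × (∀ z → Changed π σ z → toℕ m₁ ≤ toℕ z)) ×
    (Changed π σ m₂ × ¬ SameBlock π m₁ m₂ ×
       (∀ z → Changed π σ z → ¬ SameBlock π m₁ z → toℕ m₂ ≤ toℕ z)) ×
    (SameBlock π m₁ x × toℕ x < toℕ m₂ ×
       (∀ z → SameBlock π m₁ z → toℕ z < toℕ m₂ → toℕ z ≤ toℕ x)) ×
    ℓ ≡ suc (toℕ x)

-- Rooted plane trees.  A non-root vertex carries a label (i , j),
-- meaning i_j.  The root (label ∞) is implicit: a tree is given by the
-- list (forest) of the subtrees of the root's children, left to right.

data PTree : Set where
  node : ℕ × ℕ → List PTree → PTree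

labelOf : PTree → ℕ × ℕ
labelOf (node l _) = l

mutual
  size : PTree → ℕ
  size (node _ ts) = suc (sizeF ts)

  sizeF : List PTree → ℕ
  sizeF []       = 0
  sizeF (t ∷ ts) = size t + sizeF ts

-- Vertex records (ω(v) , ω(parent v) , label v) in depth-first
-- (preorder) order; verts w p t numbers t starting from w, its parent
-- having number p.
Vtx : Set
Vtx = ℕ × ℕ × (ℕ × ℕ)

mutual
  verts : ℕ → ℕ → PTree → List Vtx
  verts w p (node l ts) = (w , p , l) ∷ vertsF (suc w) w ts

  vertsF : ℕ → ℕ → List PTree → List Vtx
  vertsF w p []       = []
  vertsF w p (t ∷ ts) = verts w p t ++ vertsF (w + size t) p ts

-- all non-root vertices of the tree with root children F: the root has
-- ω = 1, so these are numbered 2,…, in preorder.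
nonRoot : List PTree → List Vtx
nonRoot F = vertsF 2 1 F

vlabel : Vtx → ℕ × ℕ
vlabel (_ , _ , l) = l

ChildrenOK : ℕ → List PTree → Set
ChildrenOK d ts =
  (∃ λ q → length ts ≡ q * d) ×
  (∀ (p : Fin (length ls)) (i : ℕ) → lookup ls p ≡ (i , 1) →
     ∀ s → s < d → Σ (Fin (length ls)) λ q →
       toℕ q ≡ toℕ p + s × lookup ls q ≡ (i , suc s)) ×
  (∀ (p q : Fin (length ls)) → proj₁ (lookup ls p) < proj₁ (lookup ls q) →
     toℕ q < toℕ p)
  where ls = map labelOf ts

mutual
  AllNodes : (List PTree → Set) → PTree → Set
  AllNodes P (node _ ts) = P ts × AllNodesF P ts

  AllNodesF : (List PTree → Set) → List PTree → Set
  AllNodesF P []       = ⊤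
  AllNodesF P (t ∷ ts) = AllNodes P t × AllNodesF P ts

InRange : ℕ → ℕ → ℕ × ℕ → Set
InRange d k (i , j) = (1 ≤ i × i ≤ k) × (1 ≤ j × j ≤ d)

IsParkingTree : ℕ → ℕ → List PTree → Set
IsParkingTree d k F =
  length (nonRoot F) ≡ d * k ×
  All (λ v → InRange d k (vlabel v)) (nonRoot F) ×
  Unique (map vlabel (nonRoot F)) ×
  ChildrenOK d F × AllNodesF (ChildrenOK d) F

-- a_i(T) = p : p is ω of the common parent of i_1,…,i_d (read off at i_1;
-- by the tree conditions i_1,…,i_d are siblings)
AEntry : List PTree → ℕ → ℕ → Set
AEntry F i p = ∃ λ w → (w , p , (i , 1)) ∈ nonRoot F

Edge : List PTree → ℕ → ℕ → ℕ → Set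
Edge F i u v = ∃ λ j → ∃ λ s → (1 ≤ j × j ≤ i) × (u , v , (j , s)) ∈ nonRoot F

Connected : List PTree → ℕ → ℕ → ℕ → Set
Connected F i = EqClosure (Edge F i)

MergePoint : List PTree → ℕ → ℕ → Set
MergePoint F i z = ∃ λ w → ∃ λ p → ∃ λ s →
  (w , p , (i , s)) ∈ nonRoot F × (z ≡ w ⊎ z ≡ p)

InMergedBlocks : ∀ {n} → Partition n → List PTree → ℕ → Fin n → Set
InMergedBlocks π F i x = ∃ λ z → SameBlock π x z × MergePoint F i (suc (toℕ z))

module Submission where

-- Call x new at a cover π ≺ σ if it is the minimum of its π-block but not
-- of its σ-block. The proof reads off the congruences mod d from block
-- minima. The size condition on the Kreweras dual says that whenever x < y
-- lie in one block of π ∈ NC^d, the number of block minima in (x,y] is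
-- divisible by d; the size condition on π says that every union P of blocks
-- contains ≡ |P| block minima. Since the chain has length k,
-- every step has exactly d new elements, they lie in a single σ-block, and
-- for x < y in one π-block either all or none of them lie in (x,y].
-- With the arc from the label p of the step to each new element, this rules
-- out crossings between arcs of different steps and puts the later children
-- of a vertex first. The arcs of T (in its preorder numbering) have the same
-- properties, and these determine the step of every vertex from the parents
-- a_i: at the first vertex where two such step functions differ, each of
-- them must use the other's step further right, which forces the two steps
-- to be equal. Hence the new elements of step i are exactly i_1,…,i_d.

open import Defs
open import Data.Nat using (ℕ; zero; suc; _+_; _*_; _≤_; _<_; z≤n; s≤s; _≤?_; _<?_; _≟_)
open import Data.Nat.Properties
open import Data.Nat.Divisibility using (_∣_; divides; ∣m∣n⇒∣m+n; ∣m+n∣m⇒∣n; _∣0; ∣⇒≤; n∣m*n)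
open import Data.Fin using (Fin; toℕ; inject₁; fromℕ; fromℕ<) renaming (zero to fzero; suc to fsuc)
import Data.Fin.Properties as Fin
open import Data.List using (List; []; _∷_; length; map; filter; lookup; allFin; tabulate)
open import Data.List.Properties using (length-++)
open import Data.List.Membership.Propositional using (_∈_)
open import Data.List.Membership.Propositional.Properties using (∈-++⁺ˡ; ∈-++⁺ʳ; ∈-++⁻; ∈-lookup)
open import Data.List.Relation.Unary.Any using (here; there; index)
open import Data.List.Relation.Unary.Any.Properties using (lookup-index)
open import Data.List.Relation.Unary.All as All using (All; []; _∷_)
import Data.List.Relation.Unary.All.Properties as All
open import Data.List.Relation.Unary.AllPairs using (AllPairs; []; _∷_)
import Data.List.Relation.Unary.AllPairs.Properties as AllPairs
open import Data.List.Relation.Unary.Unique.Propositional using (Unique)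
open import Data.Product using (∃; _×_; _,_; proj₁; proj₂)
open import Data.Sum using (_⊎_; inj₁; inj₂; [_,_]′)
open import Data.Empty using (⊥)
open import Data.Unit using (tt)
open import Data.Bool using (true; false)
open import Function using (_∘_; id; case_of_)
open import Function.Bundles using (_⇔_; mk⇔)
open import Relation.Nullary using (¬_; Dec; yes; no; contradiction)
open import Relation.Nullary.Decidable using (_×-dec_; _→-dec_; ¬?)
open import Relation.Unary using (Decidable)
open import Relation.Binary.Construct.Closure.Equivalence using (fold; return; symmetric; transitive)
open import Relation.Binary.Construct.Closure.ReflexiveTransitive using (ε)
open import Relation.Binary using (IsEquivalence; tri<; tri≈; tri>)
open import Relation.Binary.PropositionalEquality using (_≡_; _≢_; refl; sym; trans; cong; cong₂; subst; subst₂; module ≡-Reasoning)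
open import Algebra.Properties.CommutativeMonoid.Sum +-0-commutativeMonoid using (sum; sum-cong-≗; ∑-distrib-+; ∑-comm)

-- Counting in Fin n

indicator : {A : Set} → Dec A → ℕ
indicator (yes _) = 1
indicator (no  _) = 0

indicator-yes : {A : Set} (A? : Dec A) → A → indicator A? ≡ 1
indicator-yes (yes _) a = refl
indicator-yes (no ¬a) a = contradiction a ¬a

indicator-no : {A : Set} (A? : Dec A) → ¬ A → indicator A? ≡ 0
indicator-no (yes a) ¬a = contradiction a ¬a
indicator-no (no _)  ¬a = refl

opaque
  count : ∀ {n} {P : Fin n → Set} → Decidable P → ℕ
  count P? = sum (indicator ∘ P?)

  count-cong : ∀ {n} {P Q : Fin n → Set} (P? : Decidable P) (Q? : Decidable Q) →
               (∀ x → P x → Q x) → (∀ x → Q x → P x) → count P? ≡ count Q?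
  count-cong P? Q? P⇒Q Q⇒P = sum-cong-≗ eq
    where
    eq : ∀ x → indicator (P? x) ≡ indicator (Q? x)
    eq x with P? x
    ... | yes p = sym (indicator-yes (Q? x) (P⇒Q x p))
    ... | no ¬p = sym (indicator-no (Q? x) (¬p ∘ Q⇒P x))

  count-⊎ : ∀ {n} {P Q R : Fin n → Set} (P? : Decidable P) (Q? : Decidable Q) (R? : Decidable R) →
            (∀ x → P x → Q x ⊎ R x) → (∀ x → Q x → P x) → (∀ x → R x → P x) →
            (∀ x → Q x → ¬ R x) → count P? ≡ count Q? + count R?
  count-⊎ P? Q? R? P⇒Q⊎R Q⇒P R⇒P disjoint =
    trans (sum-cong-≗ eq) (∑-distrib-+ (indicator ∘ Q?) (indicator ∘ R?))
    where
    eq : ∀ x → indicator (P? x) ≡ indicator (Q? x) + indicator (R? x)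
    eq x with Q? x
    ... | yes q = trans (indicator-yes (P? x) (Q⇒P x q)) (cong suc (sym (indicator-no (R? x) (disjoint x q))))
    ... | no ¬q with P? x
    ...   | yes p = sym (indicator-yes (R? x) ([ (λ q → contradiction q ¬q) , id ]′ (P⇒Q⊎R x p)))
    ...   | no ¬p = sym (indicator-no (R? x) (¬p ∘ R⇒P x))

  count-fsuc : ∀ {n} {P : Fin (suc n) → Set} (P? : Decidable P) → ¬ P fzero → count P? ≡ count (P? ∘ fsuc)
  count-fsuc P? ¬p₀ = cong (_+ count (P? ∘ fsuc)) (indicator-no (P? fzero) ¬p₀)

  count-none : ∀ {n} {P : Fin n → Set} (P? : Decidable P) → (∀ x → ¬ P x) → count P? ≡ 0
  count-none {zero}  P? none = refl
  count-none {suc n} P? none =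
    cong₂ _+_ (indicator-no (P? fzero) (none fzero)) (count-none (P? ∘ fsuc) (none ∘ fsuc))

  count-unique : ∀ {n} {P : Fin n → Set} (P? : Decidable P) x → P x → (∀ y → P y → y ≡ x) → count P? ≡ 1
  count-unique P? fzero p unique =
    cong₂ _+_ (indicator-yes (P? fzero) p) (count-none (P? ∘ fsuc) λ y py → contradiction (unique (fsuc y) py) λ ())
  count-unique P? (fsuc x) p unique =
    cong₂ _+_ (indicator-no (P? fzero) λ p₀ → contradiction (unique fzero p₀) λ ())
              (count-unique (P? ∘ fsuc) x p λ y py → Fin.suc-injective (unique (fsuc y) py))

  count-positive : ∀ {n} {P : Fin n → Set} (P? : Decidable P) x → P x → 1 ≤ count P?
  count-positive P? fzero    p = ≤-trans (≤-reflexive (sym (indicator-yes (P? fzero) p))) (m≤m+n _ _)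
  count-positive P? (fsuc x) p = ≤-trans (count-positive (P? ∘ fsuc) x p) (m≤n+m _ _)

  count-all : ∀ n → count {n} (λ _ → yes tt) ≡ n
  count-all zero = refl
  count-all (suc n) = cong suc (count-all n)

  -- Double counting of the pairs (j, x) with `f j ≡ x`: each `j` lies in one pair, and each `x`
  -- satisfying `P` lies in one by surjectivity and injectivity.
  count-image : ∀ {m n} {P : Fin n → Set} (P? : Decidable P) (f : Fin m → Fin n) → (∀ {i j} → f i ≡ f j → i ≡ j) →
                (∀ j → P (f j)) → (∀ x → P x → ∃ λ j → f j ≡ x) → count P? ≡ m
  count-image {m} {P = P} P? f injective P∘f surjective = begin
    count P?                              ≡⟨ sum-cong-≗ perElement ⟩
    sum (λ x → count (λ j → f j Fin.≟ x)) ≡⟨ ∑-comm (λ x j → indicator (f j Fin.≟ x)) ⟩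
    sum (λ j → count (λ x → f j Fin.≟ x)) ≡⟨ sum-cong-≗ (λ j → count-unique (λ x → f j Fin.≟ x) (f j) refl λ _ → sym) ⟩
    count {m} (λ _ → yes tt)              ≡⟨ count-all m ⟩
    m                                     ∎
    where
    open ≡-Reasoning
    perElement : ∀ x → indicator (P? x) ≡ count (λ j → f j Fin.≟ x)
    perElement x with P? x
    ... | no ¬p = sym (count-none (λ j → f j Fin.≟ x) λ { j refl → ¬p (P∘f j) })
    ... | yes p with surjective x p
    ...   | j , refl = sym (count-unique (λ i → f i Fin.≟ x) j refl λ i → injective)

  length-filter-tabulate : ∀ {n} {A : Set} {P : A → Set} (P? : Decidable P) (f : Fin n → A) →
                           length (filter P? (tabulate f)) ≡ count (P? ∘ f)
  length-filter-tabulate {zero}  P? f = refl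
  length-filter-tabulate {suc n} P? f with P? (f fzero)
  ... | yes _ = cong suc (length-filter-tabulate P? (f ∘ fsuc))
  ... | no _  = length-filter-tabulate P? (f ∘ fsuc)

  length-filter-allFin : ∀ {n} {P : Fin n → Set} (P? : Decidable P) → length (filter P? (allFin n)) ≡ count P?
  length-filter-allFin P? = length-filter-tabulate P? id

-- An element of `Q` outside `P` would make the count of `Q` strictly larger. Later this turns "at
-- least d out of exactly d" into "all of them".
count-saturated : ∀ {n} {P Q : Fin n → Set} (P? : Decidable P) (Q? : Decidable Q) →
                  (∀ x → P x → Q x) → count Q? ≤ count P? → ∀ x → Q x → P x
count-saturated {P = P} {Q = Q} P? Q? P⇒Q Q≤P x q with P? x
... | yes p = p
... | no ¬p = contradiction Q≤P (<⇒≱ (begin-strict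
  count P?               <⟨ m<m+n _ (count-positive Q∖P? x (q , ¬p)) ⟩
  count P? + count Q∖P?  ≡⟨ count-⊎ Q? P? Q∖P? split P⇒Q (λ _ → proj₁) (λ _ p → λ (_ , ¬p) → ¬p p) ⟨
  count Q?               ∎))
  where
  open ≤-Reasoning
  Q∖P? : Decidable (λ y → Q y × ¬ P y)
  Q∖P? = λ y → Q? y ×-dec ¬? (P? y)
  split : ∀ y → Q y → P y ⊎ (Q y × ¬ P y)
  split y q with P? y
  ... | yes p = inj₁ p
  ... | no ¬p = inj₂ (q , ¬p)

-- Congruences modulo d and least elements

infix 4 _≡_+multipleOf_

-- Congruence modulo `d` together with `n ≤ m`, phrased without subtraction so that such relations
-- can be added up.
_≡_+multipleOf_ : ℕ → ℕ → ℕ → Set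
m ≡ n +multipleOf d = ∃ λ c → d ∣ c × m ≡ n + c

sum-+multipleOf : ∀ {n} d (f g : Fin n → ℕ) → (∀ x → f x ≡ g x +multipleOf d) → sum f ≡ sum g +multipleOf d
sum-+multipleOf {zero}  d f g f≡g = 0 , d ∣0 , refl
sum-+multipleOf {suc n} d f g f≡g with f≡g fzero | sum-+multipleOf d (f ∘ fsuc) (g ∘ fsuc) (f≡g ∘ fsuc)
... | c , d∣c , eq | e , d∣e , eq′ = c + e , ∣m∣n⇒∣m+n d∣c d∣e , trans (cong₂ _+_ eq eq′) (+-interchange (g fzero) c _ e)
  where open import Algebra.Properties.CommutativeSemigroup +-commutativeSemigroup renaming (interchange to +-interchange)

least : ∀ {n} {P : Fin n → Set} → Decidable P → ∀ x → P x → ∃ λ m → P m × (∀ y → P y → toℕ m ≤ toℕ y)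
least {suc n} P? x p with P? fzero
... | yes p₀ = fzero , p₀ , λ _ _ → z≤n
least {suc n} P? fzero    p | no ¬p₀ = contradiction p ¬p₀
least {suc n} P? (fsuc x) p | no ¬p₀ with least (P? ∘ fsuc) x p
... | m , pm , m≤ = fsuc m , pm , λ { fzero p₀ → contradiction p₀ ¬p₀ ; (fsuc y) py → s≤s (m≤ y py) }

-- Blocks of a partition are counted through their minima

IsMin : ∀ {n} → Partition n → Fin n → Set
IsMin τ x = ∀ y → SameBlock τ x y → toℕ x ≤ toℕ y

isMin? : ∀ {n} (τ : Partition n) → Decidable (IsMin τ)
isMin? τ x = Fin.all? λ y → (τ x ≟ τ y) →-dec (toℕ x ≤? toℕ y)

blockMin : ∀ {n} (τ : Partition n) x → ∃ λ m → SameBlock τ x m × IsMin τ m × toℕ m ≤ toℕ x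
blockMin τ x with least (λ y → τ x ≟ τ y) x refl
... | m , x∼m , m≤ = m , x∼m , (λ y m∼y → m≤ y (trans x∼m m∼y)) , m≤ x refl

isMin-unique : ∀ {n} (τ : Partition n) {x y} → IsMin τ x → IsMin τ y → SameBlock τ x y → x ≡ y
isMin-unique τ xmin ymin x∼y = Fin.toℕ-injective (≤-antisym (xmin _ x∼y) (ymin _ (sym x∼y)))

isMin-antitone : ∀ {n} {π σ : Partition n} → π ≤ₚ σ → ∀ {x} → IsMin σ x → IsMin π x
isMin-antitone π≤σ xmin y x∼y = xmin y (π≤σ _ _ x∼y)

-- Each element of `P` is paired with the minimum of its block, which is again in `P`. Summed over
-- the minima, each block in `P` contributes its size, which is 1 plus a multiple of `d`.
count-closed : ∀ {n} d (τ : Partition n) → AllBlocksOneMod d τ →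
               {P : Fin n → Set} (P? : Decidable P) → (∀ {x y} → SameBlock τ x y → P x → P y) →
               count P? ≡ count (λ x → P? x ×-dec isMin? τ x) +multipleOf d
count-closed {n} d τ blocks {P} P? closed = 
  subst₂ (λ m n → m ≡ n +multipleOf d) (sym doubleCount) minSum (sum-+multipleOf d _ _ perMin)
  where
  pair? : ∀ x m → Dec ((P m × IsMin τ m) × SameBlock τ m x)
  pair? x m = (P? m ×-dec isMin? τ m) ×-dec (τ m ≟ τ x)

  perElement : ∀ x → indicator (P? x) ≡ count (pair? x)
  perElement x with P? x
  ... | no ¬p = sym (count-none (pair? x) λ m → λ ((pm , _) , m∼x) → ¬p (closed m∼x pm))
  ... | yes p with blockMin τ x
  ...   | m , x∼m , mmin , _ = sym (count-unique (pair? x) m ((closed x∼m p , mmin) , sym x∼m)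
            λ m′ → λ ((_ , m′min) , m′∼x) → isMin-unique τ m′min mmin (trans m′∼x x∼m))

  opaque
    unfolding count

    doubleCount : count P? ≡ sum (λ m → count (λ x → pair? x m))
    doubleCount = trans (sum-cong-≗ perElement) (∑-comm λ x m → indicator (pair? x m))

    minSum : sum (λ m → indicator (P? m ×-dec isMin? τ m)) ≡ count (λ m → P? m ×-dec isMin? τ m)
    minSum = refl

  perMin : ∀ m → count (λ x → pair? x m) ≡ indicator (P? m ×-dec isMin? τ m) +multipleOf d
  -- The decision about `m` becomes a variable, so that one case split reduces both the count and
  -- the indicator.
  perMin m = byCases (P? m ×-dec isMin? τ m)
    where
    byCases : (pm? : Dec (P m × IsMin τ m)) → count (λ x → pm? ×-dec (τ m ≟ τ x)) ≡ indicator pm? +multipleOf d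
    byCases (no ¬pm) = 0 , d ∣0 , count-none (λ x → no ¬pm ×-dec (τ m ≟ τ x)) λ x → ¬pm ∘ proj₁
    byCases (yes pm) with blocks m
    ... | q , eq = q * d , n∣m*n q ,
      trans (count-cong (λ x → yes pm ×-dec (τ m ≟ τ x)) (λ x → τ m ≟ τ x) (λ _ → proj₂) (λ _ m∼x → pm , m∼x))
            (trans (sym (length-filter-allFin (λ x → τ m ≟ τ x))) eq)

-- Counting in half-open intervals

In : ∀ {n} → ℕ → ℕ → Fin n → Set
In a b x = a ≤ toℕ x × toℕ x < b

in? : ∀ {n} a b → Decidable (In {n} a b)
in? a b x = (a ≤? toℕ x) ×-dec (toℕ x <? b)

module _ {n} {P : Fin n → Set} (P? : Decidable P) where

  opaque
    countIn : ℕ → ℕ → ℕ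
    countIn a b = count (λ x → in? a b x ×-dec P? x)

    countIn≡count : ∀ a b → countIn a b ≡ count (λ x → in? a b x ×-dec P? x)
    countIn≡count a b = refl

    countIn-split : ∀ {a b c} → a ≤ b → b ≤ c → countIn a c ≡ countIn a b + countIn b c
    countIn-split {a} {b} {c} a≤b b≤c =
      count-⊎ (λ x → in? a c x ×-dec P? x) (λ x → in? a b x ×-dec P? x) (λ x → in? b c x ×-dec P? x)
        (λ x ((a≤x , x<c) , p) → [ (λ x<b → inj₁ ((a≤x , x<b) , p)) , (λ b≤x → inj₂ ((b≤x , x<c) , p)) ]′ (<-≤-connex (toℕ x) b))
        (λ x ((a≤x , x<b) , p) → (a≤x , <-≤-trans x<b b≤c) , p)
        (λ x ((b≤x , x<c) , p) → (≤-trans a≤b b≤x , x<c) , p)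
        (λ x ((_ , x<b) , _) ((b≤x , _) , _) → <⇒≱ x<b b≤x)

    countIn-none : ∀ a b → (∀ x → In a b x → ¬ P x) → countIn a b ≡ 0
    countIn-none a b none = count-none (λ x → in? a b x ×-dec P? x) λ x (x∈ , p) → none x x∈ p

    countIn-unique : ∀ a b x → In a b x → P x → (∀ y → In a b y → P y → y ≡ x) → countIn a b ≡ 1
    countIn-unique a b x x∈ p unique =
      count-unique (λ x → in? a b x ×-dec P? x) x (x∈ , p) λ y (y∈ , py) → unique y y∈ py

In-singleton : ∀ {n} {x y : Fin n} → In (toℕ x) (suc (toℕ x)) y → y ≡ x
In-singleton (x≤y , y≤x) = Fin.toℕ-injective (≤-antisym (≤-pred y≤x) x≤y)

-- Noncrossing partitions and their Kreweras duals

unprimed<primed : ∀ {m n} → m ≤ n → 2 * m < 2 * n + 1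
unprimed<primed {m} {n} m≤n = subst (2 * m <_) (+-comm 1 (2 * n)) (s≤s (*-monoʳ-≤ 2 m≤n))

unprimed<primed⁻¹ : ∀ {m n} → 2 * m < 2 * n + 1 → m ≤ n
unprimed<primed⁻¹ {m} {n} p = *-cancelˡ-≤ 2 (≤-pred (subst (2 * m <_) (+-comm (2 * n) 1) p))

primed<primed⁻¹ : ∀ {m n} → 2 * m + 1 < 2 * n + 1 → m < n
primed<primed⁻¹ {m} {n} p = *-cancelˡ-< 2 m n (+-cancelʳ-< 1 (2 * m) (2 * n) p)

primed<unprimed : ∀ {m n} → m < n → 2 * m + 1 < 2 * n
primed<unprimed {m} {n} m<n = ≤-trans (≤-reflexive 2m+2) (*-monoʳ-≤ 2 m<n)
  where
  2m+2 : suc (2 * m + 1) ≡ 2 * suc m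
  2m+2 = trans (cong suc (+-comm (2 * m) 1)) (sym (*-suc 2 m))

primed<unprimed⁻¹ : ∀ {m n} → 2 * m + 1 < 2 * n → m < n
primed<unprimed⁻¹ {m} {n} p = *-cancelˡ-< 2 m n (≤-trans (s≤s (m≤m+n (2 * m) 1)) p)

module _ {n} (τ : Partition n) where

  Closed : ℕ → ℕ → Set
  Closed a b = ∀ x y → SameBlock τ x y → In a b x → In a b y

  closed? : ∀ a b → Dec (Closed a b)
  closed? a b = Fin.all? λ x → Fin.all? λ y → (τ x ≟ τ y) →-dec (in? a b x →-dec in? a b y)

  module _ (nc : NonCrossing τ) where

    noncrossing : ∀ {a b c e} → toℕ a < toℕ b → toℕ b < toℕ c → toℕ c < toℕ e →
                  SameBlock τ a c → SameBlock τ b e → SameBlock τ a b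
    noncrossing {a} {b} {c} {e} a<b b<c c<e a∼c b∼e with τ a ≟ τ b
    ... | yes a∼b = a∼b
    ... | no  a≁b = contradiction (a∼c , b∼e , a≁b) (nc a b c e a<b b<c c<e)

    -- A block with one element strictly between `x` and `y` and another outside would cross or
    -- contain the pair `x`, `y`. Either way it is the block of `x`, which `gap` keeps out of the
    -- interval.
    closed-gap : ∀ {x y} → SameBlock τ x y → (∀ z → SameBlock τ x z → ¬ In (suc (toℕ x)) (toℕ y) z) →
                 Closed (suc (toℕ x)) (toℕ y)
    closed-gap {x} {y} x∼y gap u v u∼v u∈@(x<u , u<y) with <-≤-connex (toℕ v) (suc (toℕ x)) | <-≤-connex (toℕ v) (toℕ y)
    ... | inj₂ x<v | inj₁ v<y = x<v , v<y
    ... | inj₁ v≤x | _ with m≤n⇒m<n∨m≡n (≤-pred v≤x)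
    ...   | inj₁ v<x = contradiction u∈ (gap u (trans (sym (noncrossing v<x x<u u<y (sym u∼v) x∼y)) (sym u∼v)))
    ...   | inj₂ v≡x = contradiction u∈ (gap u (trans (cong τ (sym (Fin.toℕ-injective v≡x))) (sym u∼v)))
    closed-gap {x} {y} x∼y gap u v u∼v u∈@(x<u , u<y) | inj₂ x<v | inj₂ y≤v with m≤n⇒m<n∨m≡n y≤v
    ...   | inj₁ y<v = contradiction u∈ (gap u (noncrossing x<u u<y y<v x∼y u∼v))
    ...   | inj₂ y≡v = contradiction u∈ (gap u (trans x∼y (trans (cong τ (Fin.toℕ-injective y≡v)) (sym u∼v))))

    -- Each outermost block of a closed interval contributes one minimum,
    -- and the minima nested inside it contribute a multiple of d.
    minima-closed : ∀ d a ℓ b → b ≤ a + ℓ → a ≤ b → b ≤ n → Closed a b →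
                    (∀ x y → toℕ x < toℕ y → SameBlock τ x y → a ≤ toℕ x → toℕ y < b →
                       d ∣ countIn (isMin? τ) (suc (toℕ x)) (suc (toℕ y))) →
                    countIn (isMin? τ) a b ≡ countIn (λ s → closed? a (suc (toℕ s))) a b +multipleOf d
    minima-closed d a ℓ b b≤a+ℓ a≤b b≤n cl nested with m≤n⇒m<n∨m≡n a≤b
    ... | inj₂ refl = 0 , d ∣0 , trans (countIn-none (isMin? τ) a a λ x x∈ _ → empty x x∈)
            (sym (trans (+-identityʳ _) (countIn-none (λ s → closed? a (suc (toℕ s))) a a λ x x∈ _ → empty x x∈)))
      where
      empty : ∀ (x : Fin n) → ¬ In a a x
      empty x (a≤x , x<a) = <⇒≱ x<a a≤x
    minima-closed d a zero b b≤a+ℓ a≤b b≤n cl nested | inj₁ a<b =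
      contradiction a<b (≤⇒≯ (subst (b ≤_) (+-identityʳ a) b≤a+ℓ))
    -- Induction on the bound `ℓ` for the length. With `y` the last element of the interval and `m`
    -- the minimum of its block, [m,y] is the span of the rightmost outermost block, and the
    -- induction hypothesis applies to [a,m).
    minima-closed d a (suc ℓ) (suc b) b≤a+ℓ a≤b b<n cl nested | inj₁ (s≤s a≤b′)
      with fromℕ< b<n | sym (Fin.toℕ-fromℕ< b<n)
    ... | y | refl with blockMin τ y
    ... | m , y∼m , mmin , m≤y with cl y m y∼m (a≤b′ , ≤-refl)
    ... | a≤m , _ = c + e , ∣m∣n⇒∣m+n d∣c d∣e , (begin
      countIn min? a (suc (toℕ y))
        ≡⟨ countIn-split min? a≤m (m≤n⇒m≤1+n m≤y) ⟩
      countIn min? a (toℕ m) + countIn min? (toℕ m) (suc (toℕ y))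
        ≡⟨ cong₂ _+_ eq (countIn-split min? (n≤1+n _) (s≤s m≤y)) ⟩
      countIn closed?ₐ a (toℕ m) + c + (countIn min? (toℕ m) (suc (toℕ m)) + e)
        ≡⟨ cong (λ t → countIn closed?ₐ a (toℕ m) + c + (t + e))
             (countIn-unique min? (toℕ m) (suc (toℕ m)) m (≤-refl , ≤-refl) mmin λ _ y∈ _ → In-singleton y∈) ⟩
      countIn closed?ₐ a (toℕ m) + c + (1 + e)
        ≡⟨ +-interchange (countIn closed?ₐ a (toℕ m)) c 1 e ⟩
      countIn closed?ₐ a (toℕ m) + 1 + (c + e)
        ≡⟨ cong (λ t → countIn closed?ₐ a (toℕ m) + t + (c + e))
             (countIn-unique closed?ₐ (toℕ m) (suc (toℕ y)) y (m≤y , ≤-refl) cl onlyLast) ⟨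
      countIn closed?ₐ a (toℕ m) + countIn closed?ₐ (toℕ m) (suc (toℕ y)) + (c + e)
        ≡⟨ cong (_+ (c + e)) (countIn-split closed?ₐ a≤m (m≤n⇒m≤1+n m≤y)) ⟨
      countIn closed?ₐ a (suc (toℕ y)) + (c + e) ∎)
      where
      open ≡-Reasoning
      open import Algebra.Properties.CommutativeSemigroup +-commutativeSemigroup renaming (interchange to +-interchange)

      min? = isMin? τ
      closed?ₐ = λ (s : Fin n) → closed? a (suc (toℕ s))
      e = countIn min? (suc (toℕ m)) (suc (toℕ y))

      -- A block with elements `u < m ≤ v` would cross or meet the pair `m`, `y`, placing `u` in the
      -- block of `m` below its minimum.
      closed-below : Closed a (toℕ m)
      closed-below u v u∼v (a≤u , u<m) with cl u v u∼v (a≤u , <-trans u<m (s≤s m≤y)) | <-≤-connex (toℕ v) (toℕ m)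
      ... | a≤v , _ | inj₁ v<m = a≤v , v<m
      ... | _ , v≤y | inj₂ m≤v = contradiction (mmin u (sym u∼m)) (<⇒≱ u<m)
        where
        u∼m : SameBlock τ u m
        u∼m with m≤n⇒m<n∨m≡n m≤v | m≤n⇒m<n∨m≡n (≤-pred v≤y)
        ... | inj₂ m≡v | _ = trans u∼v (cong τ (sym (Fin.toℕ-injective m≡v)))
        ... | inj₁ _ | inj₂ v≡y = trans u∼v (trans (cong τ (Fin.toℕ-injective v≡y)) y∼m)
        ... | inj₁ m<v | inj₁ v<y = noncrossing u<m m<v v<y u∼v (sym y∼m)

      below = minima-closed d a ℓ (toℕ m)
        (≤-trans m≤y (≤-pred (subst (suc (toℕ y) ≤_) (+-suc a ℓ) b≤a+ℓ))) a≤m (<⇒≤ (Fin.toℕ<n m)) closed-below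
        λ x z x<z x∼z a≤x z<m → nested x z x<z x∼z a≤x (<-trans z<m (s≤s m≤y))
      c = proj₁ below
      d∣c : d ∣ c
      d∣c = proj₁ (proj₂ below)
      eq : countIn min? a (toℕ m) ≡ countIn closed?ₐ a (toℕ m) + c
      eq = proj₂ (proj₂ below)

      d∣e : d ∣ e
      d∣e with m≤n⇒m<n∨m≡n m≤y
      ... | inj₁ m<y = nested m y m<y (sym y∼m) a≤m ≤-refl
      ... | inj₂ m≡y = subst (d ∣_) (sym (countIn-none min? (suc (toℕ m)) (suc (toℕ y))
                         λ x (m<x , x<1+y) _ → <⇒≱ m<x (subst (toℕ x ≤_) (sym m≡y) (≤-pred x<1+y)))) (d ∣0)

      -- A closed prefix ending inside [m,y] contains `m` and therefore `y`.
      onlyLast : ∀ s → In (toℕ m) (suc (toℕ y)) s → Closed a (suc (toℕ s)) → s ≡ y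
      onlyLast s (m≤s , s≤y) cl′ with cl′ m y (sym y∼m) (a≤m , s≤s m≤s)
      ... | _ , y≤s = Fin.toℕ-injective (≤-antisym (≤-pred s≤y) (≤-pred y≤s))

  module _ {ρ : Partition n} (kreweras : IsKreweras τ ρ) where

    -- On the circle the unprimed points between x' and y' are those of (x,y], since x' comes right
    -- after x. A block of `τ` leaving this interval would cross the pair x', y'.
    kreweras⇒closed : ∀ {x y} → toℕ x < toℕ y → SameBlock ρ x y → Closed (suc (toℕ x)) (suc (toℕ y))
    kreweras⇒closed {x} {y} x<y x∼y u v u∼v (x<u , u≤y) with <-≤-connex (toℕ x) (toℕ v) | <-≤-connex (toℕ y) (toℕ v)
    ... | inj₁ x<v | inj₂ v≤y = x<v , s≤s v≤y
    ... | inj₂ v≤x | _ = contradiction (sym u∼v , x∼y , λ ())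
          (proj₁ kreweras (v , false) (x , true) (u , false) (y , true)
            (unprimed<primed v≤x) (primed<unprimed x<u) (unprimed<primed (≤-pred u≤y)))
    ... | inj₁ x<v | inj₁ y<v = contradiction (x∼y , u∼v , λ ())
          (proj₁ kreweras (x , true) (u , false) (y , true) (v , false)
            (primed<unprimed x<u) (unprimed<primed (≤-pred u≤y)) (primed<unprimed y<v))

    -- Maximality of `ρ` is applied to the partition `pairing`, whose only nontrivial block is
    -- {x',y'}.
    closed⇒kreweras : NonCrossing τ → ∀ {x y} → toℕ x < toℕ y → Closed (suc (toℕ x)) (suc (toℕ y)) → SameBlock ρ x y
    closed⇒kreweras nc {x} {y} x<y cl = proj₂ kreweras pairing joint x y (trans (pairing-other (<⇒≢ x<y ∘ cong toℕ)) (sym pairing-y))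
      where
      pairing : Partition n
      pairing z with z Fin.≟ y
      ... | yes _ = toℕ x
      ... | no  _ = toℕ z

      pairing-y : pairing y ≡ toℕ x
      pairing-y with y Fin.≟ y
      ... | yes _ = refl
      ... | no y≢y = contradiction refl y≢y

      pairing-other : ∀ {z} → z ≢ y → pairing z ≡ toℕ z
      pairing-other {z} z≢y with z Fin.≟ y
      ... | yes z≡y = contradiction z≡y z≢y
      ... | no  _ = refl

      pairing-pair : ∀ a c → SameBlock pairing a c → toℕ a < toℕ c → a ≡ x × c ≡ y
      pairing-pair a c a∼c a<c with a Fin.≟ y | c Fin.≟ y
      ... | yes refl | yes refl = contradiction a<c (<-irrefl refl)
      ... | yes refl | no _ = contradiction (subst (toℕ y <_) (sym a∼c) a<c) (<-asym x<y)
      ... | no _ | yes c≡y = Fin.toℕ-injective a∼c , c≡y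
      ... | no _ | no _ = contradiction a<c (<-irrefl a∼c)

      joint : NonCrossingOn circPos (Joint τ pairing)
      joint (a , false) (b , false) (c , false) (e , false) a<b b<c c<e (a∼c , b∼e , a≁b) =
        nc a b c e (*-cancelˡ-< 2 _ _ a<b) (*-cancelˡ-< 2 _ _ b<c) (*-cancelˡ-< 2 _ _ c<e) (a∼c , b∼e , a≁b)
      joint (a , true) (b , true) (c , true) (e , true) a<b b<c c<e (a∼c , b∼e , a≁b)
        with pairing-pair a c a∼c (primed<primed⁻¹ (<-trans a<b b<c)) | pairing-pair b e b∼e (primed<primed⁻¹ (<-trans b<c c<e))
      ... | refl , refl | refl , _ = <-irrefl refl a<b
      -- In the two alternating cases the primed pair must be x', y', and the unprimed pair would
      -- join a point of (x,y] to one outside.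
      joint (a , false) (b , true) (c , false) (e , true) a<b b<c c<e (a∼c , b∼e , _)
        with pairing-pair b e b∼e (primed<primed⁻¹ (<-trans b<c c<e))
      ... | refl , refl = <⇒≱ (proj₁ (cl c a (sym a∼c) (primed<unprimed⁻¹ b<c , s≤s (unprimed<primed⁻¹ c<e)))) (unprimed<primed⁻¹ a<b)
      joint (a , true) (b , false) (c , true) (e , false) a<b b<c c<e (a∼c , b∼e , _)
        with pairing-pair a c a∼c (primed<primed⁻¹ (<-trans a<b b<c))
      ... | refl , refl = <⇒≱ (primed<unprimed⁻¹ c<e) (≤-pred (proj₂ (cl b e b∼e (primed<unprimed⁻¹ a<b , s≤s (unprimed<primed⁻¹ b<c)))))
      joint (a , false) (b , _) (c , true) (e , _) _ _ _ (() , _)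
      joint (a , true) (b , _) (c , false) (e , _) _ _ _ (() , _)
      joint (a , false) (b , false) (c , false) (e , true) _ _ _ (_ , () , _)
      joint (a , false) (b , true) (c , false) (e , false) _ _ _ (_ , () , _)
      joint (a , true) (b , false) (c , true) (e , true) _ _ _ (_ , () , _)
      joint (a , true) (b , true) (c , true) (e , false) _ _ _ (_ , () , _)

    -- The dual block of `x` consists of `x` and the `s > x` for which (x,s] is closed. Elements
    -- `s < x` or `s ≥ y` cannot occur, since the closed interval between `s` and `x` would separate
    -- `x` from `y`.
    blockSize-dual : NonCrossing τ → ∀ {x y} → toℕ x < toℕ y → SameBlock τ x y →
                     blockSize ρ x ≡ 1 + countIn (λ s → closed? (suc (toℕ x)) (suc (toℕ s))) (suc (toℕ x)) (toℕ y)
    blockSize-dual nc {x} {y} x<y x∼y = begin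
      blockSize ρ x
        ≡⟨ length-filter-allFin (λ s → ρ x ≟ ρ s) ⟩
      count (λ s → ρ x ≟ ρ s)
        ≡⟨ count-⊎ (λ s → ρ x ≟ ρ s) (Fin._≟ x) later? split (λ { s refl → refl })
             (λ s ((x<s , _) , cl) → closed⇒kreweras nc x<s cl) (λ { s refl ((x<x , _) , _) → <-irrefl refl x<x }) ⟩
      count (Fin._≟ x) + count later?
        ≡⟨ cong₂ _+_ (count-unique (Fin._≟ x) x refl λ _ → id) (sym (countIn≡count _ _ _)) ⟩
      1 + countIn (λ s → closed? (suc (toℕ x)) (suc (toℕ s))) (suc (toℕ x)) (toℕ y) ∎
      where
      open ≡-Reasoning

      Later : Fin n → Set
      Later s = In (suc (toℕ x)) (toℕ y) s × Closed (suc (toℕ x)) (suc (toℕ s))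

      later? : Decidable Later
      later? s = in? (suc (toℕ x)) (toℕ y) s ×-dec closed? (suc (toℕ x)) (suc (toℕ s))

      split : ∀ s → SameBlock ρ x s → s ≡ x ⊎ Later s
      split s x∼s with <-cmp (toℕ s) (toℕ x)
      ... | tri≈ _ s≡x _ = inj₁ (Fin.toℕ-injective s≡x)
      ... | tri< s<x _ _ = contradiction (≤-pred (proj₂ (kreweras⇒closed s<x (sym x∼s) x y x∼y (s<x , ≤-refl)))) (<⇒≱ x<y)
      ... | tri> _ _ x<s with <-≤-connex (toℕ s) (toℕ y)
      ...   | inj₁ s<y = inj₂ ((x<s , s<y) , kreweras⇒closed x<s x∼s)
      ...   | inj₂ y≤s = contradiction (proj₁ (kreweras⇒closed x<s x∼s y x (sym x∼y) (x<y , s≤s y≤s))) (<-irrefl refl)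

    -- Induction on the bound `ℓ` for the distance. An intermediate element of the block splits the
    -- interval. Otherwise the gap is closed, its outermost blocks correspond to the elements of the
    -- dual block of `x` other than `x`, and their number is divisible by `d`.
    minima-between : NonCrossing τ → ∀ {d} → AllBlocksOneMod d ρ → ∀ ℓ x y → toℕ x < toℕ y → toℕ y ≤ ℓ + toℕ x →
                     SameBlock τ x y → d ∣ countIn (isMin? τ) (suc (toℕ x)) (suc (toℕ y))
    minima-between nc blocks zero x y x<y y≤x x∼y = contradiction y≤x (<⇒≱ x<y)
    minima-between nc {d} blocks (suc ℓ) x y x<y y≤ℓ+x x∼y
      with Fin.any? (λ z → in? (suc (toℕ x)) (toℕ y) z ×-dec (τ x ≟ τ z))
    ... | yes (z , (x<z , z<y) , x∼z) = subst (d ∣_) (sym (countIn-split (isMin? τ) (m≤n⇒m≤1+n x<z) (m≤n⇒m≤1+n z<y)))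
      (∣m∣n⇒∣m+n (minima-between nc blocks ℓ x z x<z (≤-pred (≤-trans z<y y≤ℓ+x)) x∼z)
                 (minima-between nc blocks ℓ z y z<y (≤-trans y≤ℓ+x (subst (_≤ ℓ + toℕ z) (+-suc ℓ (toℕ x)) (+-monoʳ-≤ ℓ x<z)))
                                 (trans (sym x∼z) x∼y)))
    ... | no gap = subst (d ∣_) (sym gapMinima) (∣m∣n⇒∣m+n d∣closed d∣c)
      where
      open ≡-Reasoning
      min? = isMin? τ
      closed?ₓ = λ (s : Fin n) → closed? (suc (toℕ x)) (suc (toℕ s))

      outermost : countIn min? (suc (toℕ x)) (toℕ y) ≡ countIn closed?ₓ (suc (toℕ x)) (toℕ y) +multipleOf d
      outermost = minima-closed nc d (suc (toℕ x)) (toℕ y) (toℕ y) (m≤n+m _ _) x<y (<⇒≤ (Fin.toℕ<n y))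
        (closed-gap nc x∼y λ z x∼z z∈ → gap (z , z∈ , x∼z))
        λ u v u<v u∼v x<u v<y → minima-between nc blocks ℓ u v u<v
          (≤-trans (≤-pred (≤-trans v<y y≤ℓ+x)) (+-monoʳ-≤ ℓ (<⇒≤ x<u))) u∼v

      c = proj₁ outermost
      d∣c : d ∣ c
      d∣c = proj₁ (proj₂ outermost)

      d∣closed : d ∣ countIn closed?ₓ (suc (toℕ x)) (toℕ y)
      d∣closed with blocks x
      ... | q , eq = divides q (suc-injective (trans (sym (blockSize-dual nc x<y x∼y)) eq))

      gapMinima : countIn min? (suc (toℕ x)) (suc (toℕ y)) ≡ countIn closed?ₓ (suc (toℕ x)) (toℕ y) + c
      gapMinima = begin
        countIn min? (suc (toℕ x)) (suc (toℕ y))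
          ≡⟨ countIn-split min? x<y (n≤1+n _) ⟩
        countIn min? (suc (toℕ x)) (toℕ y) + countIn min? (toℕ y) (suc (toℕ y))
          ≡⟨ cong (countIn min? (suc (toℕ x)) (toℕ y) +_) (countIn-none min? (toℕ y) (suc (toℕ y)) notMin) ⟩
        countIn min? (suc (toℕ x)) (toℕ y) + 0
          ≡⟨ +-identityʳ _ ⟩
        countIn min? (suc (toℕ x)) (toℕ y)
          ≡⟨ proj₂ (proj₂ outermost) ⟩
        countIn closed?ₓ (suc (toℕ x)) (toℕ y) + c ∎
        where
        notMin : ∀ s → In (toℕ y) (suc (toℕ y)) s → ¬ IsMin τ s
        notMin s s∈ smin with In-singleton s∈
        ... | refl = <⇒≱ x<y (smin x (sym x∼y))

minima-between-∣ : ∀ {n d} {τ : Partition n} → InNCd d τ → ∀ {x y} → toℕ x < toℕ y → SameBlock τ x y →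
                   d ∣ countIn (isMin? τ) (suc (toℕ x)) (suc (toℕ y))
minima-between-∣ {τ = τ} (nc , ρ , kreweras , _ , blocks) {x} {y} x<y x∼y =
  minima-between τ kreweras nc blocks (toℕ y) x y x<y (m≤m+n _ _) x∼y

-- Elements that stop being block minima

New : ∀ {n} → Partition n → Partition n → Fin n → Set
New π σ x = IsMin π x × ¬ IsMin σ x

new? : ∀ {n} (π σ : Partition n) → Decidable (New π σ)
new? π σ x = isMin? π x ×-dec ¬? (isMin? σ x)

∣-positive⇒≤ : ∀ {d c} → d ∣ c → 1 ≤ c → d ≤ c
∣-positive⇒≤ d∣c (s≤s _) = ∣⇒≤ d∣c

module Refinement {n d} {π σ : Partition n} (πNC : InNCd d π) (σNC : InNCd d σ) (π≤σ : π ≤ₚ σ) where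

  minima-split : ∀ {P : Fin n → Set} (P? : Decidable P) →
                 count (λ x → P? x ×-dec isMin? π x) ≡
                 count (λ x → P? x ×-dec isMin? σ x) + count (λ x → P? x ×-dec new? π σ x)
  minima-split {P} P? = count-⊎ (λ x → P? x ×-dec isMin? π x) (λ x → P? x ×-dec isMin? σ x) (λ x → P? x ×-dec new? π σ x)
    split (λ x (p , xmin) → p , isMin-antitone {π = π} {σ} π≤σ xmin) (λ x (p , xmin , _) → p , xmin)
    (λ x (_ , xmin) (_ , _ , ¬xmin) → ¬xmin xmin)
    where
    split : ∀ x → P x × IsMin π x → (P x × IsMin σ x) ⊎ (P x × New π σ x)
    split x (p , xmin) with isMin? σ x
    ... | yes σmin = inj₁ (p , σmin)
    ... | no ¬σmin = inj₂ (p , xmin , ¬σmin)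

  -- A union of `σ`-blocks is also a union of `π`-blocks, so its size is congruent to its number of
  -- minima for both partitions. The new elements make up the difference of these two numbers.
  ∣-new-closed : ∀ {P : Fin n → Set} (P? : Decidable P) → (∀ {x y} → SameBlock σ x y → P x → P y) →
                 d ∣ count (λ x → P? x ×-dec new? π σ x)
  ∣-new-closed {P} P? closed
    with count-closed d π (proj₁ (proj₂ (proj₂ (proj₂ πNC)))) P? (λ {x} {y} x∼y → closed (π≤σ x y x∼y))
       | count-closed d σ (proj₁ (proj₂ (proj₂ (proj₂ σNC)))) P? closed
  ... | c , d∣c , eq | e , d∣e , eq′ = ∣m+n∣m⇒∣n (subst (d ∣_) e≡c+new d∣e) d∣c
    where
    open ≡-Reasoning
    minσ = count (λ x → P? x ×-dec isMin? σ x)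
    new = count (λ x → P? x ×-dec new? π σ x)

    e≡c+new : e ≡ c + new
    e≡c+new = +-cancelˡ-≡ minσ e (c + new) (begin
      minσ + e                                    ≡⟨ eq′ ⟨
      count P?                                    ≡⟨ eq ⟩
      count (λ x → P? x ×-dec isMin? π x) + c     ≡⟨ cong (_+ c) (minima-split P?) ⟩
      minσ + new + c                              ≡⟨ +-assoc minσ new c ⟩
      minσ + (new + c)                            ≡⟨ cong (minσ +_) (+-comm new c) ⟩
      minσ + (c + new)                            ∎)

  -- Difference of the divisibilities for `π` and for `σ`, in which `x` and `y` still share a block.
  ∣-new-between : ∀ {x y} → toℕ x < toℕ y → SameBlock π x y → d ∣ countIn (new? π σ) (suc (toℕ x)) (suc (toℕ y))
  ∣-new-between {x} {y} x<y x∼y =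
    ∣m+n∣m⇒∣n (subst (d ∣_) split (minima-between-∣ πNC x<y x∼y)) (minima-between-∣ σNC x<y (π≤σ x y x∼y))
    where
    split : countIn (isMin? π) (suc (toℕ x)) (suc (toℕ y)) ≡
            countIn (isMin? σ) (suc (toℕ x)) (suc (toℕ y)) + countIn (new? π σ) (suc (toℕ x)) (suc (toℕ y))
    split = trans (countIn≡count _ _ _) (trans (minima-split (in? (suc (toℕ x)) (suc (toℕ y))))
              (sym (cong₂ _+_ (countIn≡count _ _ _) (countIn≡count _ _ _))))

  count-minima : count (isMin? π) ≡ count (isMin? σ) + count (new? π σ)
  count-minima = count-⊎ (isMin? π) (isMin? σ) (new? π σ)
    (λ x xmin → [ inj₁ , (λ ¬xmin → inj₂ (xmin , ¬xmin)) ]′ (toSum (isMin? σ x)))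
    (λ x → isMin-antitone {π = π} {σ} π≤σ) (λ x → proj₁) (λ x xmin (_ , ¬xmin) → ¬xmin xmin)
    where open import Relation.Nullary.Decidable using (toSum)

  ∣-count-new : d ∣ count (new? π σ)
  ∣-count-new = subst (d ∣_) (count-cong (λ x → yes tt ×-dec new? π σ x) (new? π σ) (λ _ → proj₂) (λ _ → tt ,_))
                  (∣-new-closed (λ _ → yes tt) λ _ _ → tt)

  new-below : ∀ {x} → New π σ x → ∃ λ y → SameBlock σ x y × ¬ SameBlock π x y
  new-below {x} (xmin , ¬xmin) with blockMin σ x
  ... | m , x∼m , mmin , m≤x = m , x∼m , λ x∼πm →
    ¬xmin (subst (IsMin σ) (Fin.toℕ-injective (≤-antisym m≤x (xmin m x∼πm))) mmin)

  -- If the minima of the `π`-blocks of `x` and `y` both remained minimal, both would be the minimum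
  -- of the common `σ`-block, and the two `π`-blocks would coincide.
  changed-new : ∀ {x} → Changed π σ x → ∃ λ w → New π σ w × SameBlock σ x w
  changed-new {x} (y , x∼y , x≁y) with blockMin π x | blockMin π y
  ... | a , x∼a , amin , _ | b , y∼b , bmin , _ with isMin? σ a | isMin? σ b
  ...   | no ¬amin | _ = a , (amin , ¬amin) , π≤σ x a x∼a
  ...   | yes _ | no ¬bmin = b , (bmin , ¬bmin) , trans x∼y (π≤σ y b y∼b)
  ...   | yes σa | yes σb = contradiction (trans x∼a (trans (cong π a≡b) (sym y∼b))) x≁y
    where
    a≡b : a ≡ b
    a≡b = isMin-unique σ σa σb (trans (sym (π≤σ x a x∼a)) (trans x∼y (π≤σ y b y∼b)))

  -- Combined with `∣-count-new` this gives at least `d` new elements for every proper refinement.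
  new-exists : ¬ (σ ≤ₚ π) → 1 ≤ count (new? π σ)
  new-exists σ≰π with Fin.any? (new? π σ)
  ... | yes (w , wnew) = count-positive (new? π σ) w wnew
  ... | no none = contradiction σ≤π σ≰π
    where
    σ≤π : σ ≤ₚ π
    σ≤π x y x∼y with π x ≟ π y
    ... | yes x∼πy = x∼πy
    ... | no x≁y with changed-new (y , x∼y , x≁y)
    ...   | w , wnew , _ = contradiction (w , wnew) none

  changed-closed : ∀ {x y} → Changed π σ x → SameBlock σ x y → Changed π σ y
  changed-closed {x} {y} (z , x∼z , x≁z) x∼y with π x ≟ π y
  ... | yes x∼πy = z , trans (sym x∼y) x∼z , λ y∼z → x≁z (trans x∼πy y∼z)
  ... | no x≁y = x , sym x∼y , λ y∼x → x≁y (sym y∼x)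

  module Merge (count-new : count (new? π σ) ≡ d) where

    -- The `σ`-block of `x` contains a positive multiple of `d` new elements, hence all `d` of them.
    new-together : ∀ {x y} → New π σ x → New π σ y → SameBlock σ x y
    new-together {x} {y} xnew ynew = proj₁ (count-saturated (λ z → (σ x ≟ σ z) ×-dec new? π σ z) (new? π σ) (λ _ → proj₂)
      (subst (_≤ _) (sym count-new)
        (∣-positive⇒≤ (∣-new-closed (λ z → σ x ≟ σ z) λ y∼z x∼y → trans x∼y y∼z)
                      (count-positive (λ z → (σ x ≟ σ z) ×-dec new? π σ z) x (refl , xnew))))
      y ynew)

    changed-together : ∀ {x y} → Changed π σ x → Changed π σ y → SameBlock σ x y
    changed-together xchg ychg with changed-new xchg | changed-new ychg
    ... | w , wnew , x∼w | v , vnew , y∼v = trans x∼w (trans (new-together wnew vnew) (sym y∼v))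

    -- The interval (x,y] contains a positive multiple of `d` new elements, hence all `d` of them.
    new-in-one-gap : ∀ {x y w v} → toℕ x < toℕ y → SameBlock π x y → New π σ w → toℕ x < toℕ w → toℕ w ≤ toℕ y →
                     New π σ v → In (suc (toℕ x)) (suc (toℕ y)) v
    new-in-one-gap {x} {y} {w} {v} x<y x∼y wnew x<w w≤y vnew = proj₁ (count-saturated within? (new? π σ) (λ _ → proj₂)
      (subst (_≤ _) (sym count-new)
        (∣-positive⇒≤ (subst (d ∣_) (countIn≡count _ _ _) (∣-new-between x<y x∼y))
                      (count-positive within? w ((x<w , s≤s w≤y) , wnew))))
      v vnew)
      where within? = λ z → in? (suc (toℕ x)) (suc (toℕ y)) z ×-dec new? π σ z

    -- The label of a cover and the gaps available to new elements

    module Label {ℓ} (isLabel : IsLabel π σ ℓ) where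

      m₁ m₂ p : Fin n
      m₁ = proj₁ isLabel
      m₂ = proj₁ (proj₂ isLabel)
      p  = proj₁ (proj₂ (proj₂ isLabel))

      private
        m₁-spec : Changed π σ m₁ × (∀ z → Changed π σ z → toℕ m₁ ≤ toℕ z)
        m₁-spec = proj₁ (proj₂ (proj₂ (proj₂ isLabel)))

        m₂-spec : Changed π σ m₂ × ¬ SameBlock π m₁ m₂ × (∀ z → Changed π σ z → ¬ SameBlock π m₁ z → toℕ m₂ ≤ toℕ z)
        m₂-spec = proj₁ (proj₂ (proj₂ (proj₂ (proj₂ isLabel))))

        p-spec : SameBlock π m₁ p × toℕ p < toℕ m₂ × (∀ z → SameBlock π m₁ z → toℕ z < toℕ m₂ → toℕ z ≤ toℕ p)
        p-spec = proj₁ (proj₂ (proj₂ (proj₂ (proj₂ (proj₂ isLabel)))))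

      label≡ : ℓ ≡ suc (toℕ p)
      label≡ = proj₂ (proj₂ (proj₂ (proj₂ (proj₂ (proj₂ isLabel)))))

      m₁-changed : Changed π σ m₁
      m₁-changed = proj₁ m₁-spec

      m₁-least : ∀ z → Changed π σ z → toℕ m₁ ≤ toℕ z
      m₁-least = proj₂ m₁-spec

      m₂-least : ∀ z → Changed π σ z → ¬ SameBlock π m₁ z → toℕ m₂ ≤ toℕ z
      m₂-least = proj₂ (proj₂ m₂-spec)

      m₁∼p : SameBlock π m₁ p
      m₁∼p = proj₁ p-spec

      p<m₂ : toℕ p < toℕ m₂
      p<m₂ = proj₁ (proj₂ p-spec)

      m₁∼changed : ∀ {x} → Changed π σ x → SameBlock σ m₁ x
      m₁∼changed = changed-together m₁-changed

      p∼new : ∀ {w} → New π σ w → SameBlock σ p w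
      p∼new wnew = trans (sym (π≤σ m₁ p m₁∼p)) (m₁∼changed (new-below wnew))

      m₁-minσ : IsMin σ m₁
      m₁-minσ y m₁∼y = m₁-least y (changed-closed m₁-changed m₁∼y)

      -- The minimum of a changed block either is new or stays minimal in the merged `σ`-block, and
      -- then it is `m₁`.
      new-or-first : ∀ {x} → Changed π σ x → (∃ λ b → New π σ b × SameBlock π x b × toℕ b ≤ toℕ x) ⊎ SameBlock π x m₁
      new-or-first {x} xchg with blockMin π x
      ... | b , x∼b , bmin , b≤x with isMin? σ b
      ...   | no ¬bmin = inj₁ (b , (bmin , ¬bmin) , x∼b , b≤x)
      ...   | yes σmin = inj₂ (trans x∼b (cong π (isMin-unique σ σmin m₁-minσ
                           (trans (sym (π≤σ x b x∼b)) (sym (m₁∼changed xchg))))))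

      new≁first : ∀ {w} → New π σ w → ¬ SameBlock π m₁ w
      new≁first (wmin , ¬wmin) m₁∼w =
        ¬wmin (subst (IsMin σ) (isMin-unique π (isMin-antitone {π = π} {σ} π≤σ m₁-minσ) wmin m₁∼w) m₁-minσ)

      m₂-new : New π σ m₂
      m₂-new with new-or-first (proj₁ m₂-spec)
      ... | inj₂ m₂∼m₁ = contradiction (sym m₂∼m₁) (proj₁ (proj₂ m₂-spec))
      ... | inj₁ (b , bnew , _ , b≤m₂) = subst (New π σ)
        (Fin.toℕ-injective (≤-antisym b≤m₂ (m₂-least b (new-below bnew) (new≁first bnew)))) bnew

      label-below : ∀ {w} → New π σ w → toℕ p < toℕ w
      label-below wnew = <-≤-trans p<m₂ (m₂-least _ (new-below wnew) (new≁first wnew))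

      -- By the maximality of `p`, an element `q > p` of the first block satisfies `m₂ ≤ q`. Then
      -- (p,q] contains the new element `m₂` and hence every new element, including `w`.
      first-gap : ∀ {q w} → New π σ w → SameBlock π m₁ q → toℕ p < toℕ q → ¬ (toℕ q < toℕ w)
      first-gap {q} wnew m₁∼q p<q q<w with <-≤-connex (toℕ q) (toℕ m₂)
      ... | inj₁ q<m₂ = <⇒≱ p<q (proj₂ (proj₂ p-spec) q m₁∼q q<m₂)
      ... | inj₂ m₂≤q =
        <⇒≱ q<w (≤-pred (proj₂ (new-in-one-gap p<q (trans (sym m₁∼p) m₁∼q) m₂-new p<m₂ m₂≤q wnew)))

      -- The block of `x` is merged but is not the first one, so its minimum `b ≤ x` is new. If `w`
      -- were in (x,y], so would be `b`.
      other-gap : ∀ {x y w} → New π σ w → SameBlock π x y → SameBlock σ x w → ¬ SameBlock π x m₁ →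
                  toℕ x < toℕ w → ¬ (toℕ w < toℕ y)
      other-gap {x} {y} wnew x∼y x∼w x≁m₁ x<w w<y with new-or-first (changed-closed (new-below wnew) (sym x∼w))
      ... | inj₂ x∼m₁ = x≁m₁ x∼m₁
      ... | inj₁ (b , bnew , _ , b≤x) =
        <⇒≱ (proj₁ (new-in-one-gap (<-trans x<w w<y) x∼y wnew x<w (<⇒≤ w<y) bnew)) b≤x

-- Step functions determined by the labels of the steps

-- The y-th non-root vertex has ω-number 2 + toℕ y; s y is the step at
-- which it is joined to its parent, and a i is the parent used in step i.
record Stepping {m k} (d : ℕ) (a : Fin k → ℕ) (s : Fin m → Fin k) : Set where
  field
    parent-below  : ∀ y → a (s y) < 2 + toℕ y
    nested        : ∀ {w u} → toℕ w < toℕ u → a (s u) < 2 + toℕ w → a (s u) ≤ a (s w)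
    siblings-desc : ∀ {w u} → toℕ w < toℕ u → a (s u) ≡ a (s w) → toℕ (s u) ≤ toℕ (s w)
    step-size     : ∀ i → count (λ y → s y Fin.≟ i) ≡ d

module _ {m k d : ℕ} {a : Fin k → ℕ} where

  open Stepping

  -- Otherwise `s′` takes the value `s w` only at or before `w`, where `s` takes it too. As both
  -- take it `d` times, `s′` would take it at `w` as well.
  delayed : {s s′ : Fin m → Fin k} → Stepping d a s → Stepping d a s′ → ∀ w →
            (∀ u → toℕ u < toℕ w → s u ≡ s′ u) → s w ≢ s′ w → ∃ λ u → toℕ w < toℕ u × s′ u ≡ s w
  delayed {s} {s′} S S′ w agree differ with Fin.any? (λ u → (toℕ w <? toℕ u) ×-dec (s′ u Fin.≟ s w))
  ... | yes later = later
  ... | no none = contradiction (sym s′w≡sw) differ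
    where
    earlier : ∀ u → s′ u ≡ s w → s u ≡ s w
    earlier u s′u≡sw with <-cmp (toℕ u) (toℕ w)
    ... | tri< u<w _ _ = trans (agree u u<w) s′u≡sw
    ... | tri≈ _ u≡w _ = cong s (Fin.toℕ-injective u≡w)
    ... | tri> _ _ w<u = contradiction (u , w<u , s′u≡sw) none

    s′w≡sw : s′ w ≡ s w
    s′w≡sw = count-saturated (λ u → s′ u Fin.≟ s w) (λ u → s u Fin.≟ s w) earlier
      (≤-reflexive (trans (step-size S (s w)) (sym (step-size S′ (s w))))) w refl

  -- The axioms of `S′` are applied to `w` and the later vertex `u` that uses the step `s w`.
  delayed-order : {s s′ : Fin m → Fin k} → Stepping d a s → Stepping d a s′ → ∀ w →
                  (∀ u → toℕ u < toℕ w → s u ≡ s′ u) → s w ≢ s′ w →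
                  a (s w) ≤ a (s′ w) × (a (s w) ≡ a (s′ w) → toℕ (s w) ≤ toℕ (s′ w))
  delayed-order {s} {s′} S S′ w agree differ with delayed S S′ w agree differ
  ... | u , w<u , s′u≡sw =
    subst (λ i → a i ≤ a (s′ w)) s′u≡sw (nested S′ w<u (subst (λ i → a i < 2 + toℕ w) (sym s′u≡sw) (parent-below S w))) ,
    subst (λ i → a i ≡ a (s′ w) → toℕ i ≤ toℕ (s′ w)) s′u≡sw (siblings-desc S′ w<u)

  stepping-unique : {s s′ : Fin m → Fin k} → Stepping d a s → Stepping d a s′ → ∀ y → s y ≡ s′ y
  stepping-unique {s} {s′} S S′ y = below (suc (toℕ y)) y ≤-refl
    where
    below : ∀ b y → toℕ y < b → s y ≡ s′ y
    below (suc b) y (s≤s y≤b) with s y Fin.≟ s′ y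
    ... | yes eq = eq
    ... | no differ with delayed-order S S′ y agree differ | delayed-order S′ S y (λ u → sym ∘ agree u) (differ ∘ sym)
      where
      agree : ∀ u → toℕ u < toℕ y → s u ≡ s′ u
      agree u u<y = below b u (<-≤-trans u<y y≤b)
    -- Exchanging the two functions gives the reverse inequalities: first the parents agree, then
    -- the steps.
    ...   | a≤a′ , ≤′ | a′≤a , ≥′ = Fin.toℕ-injective (≤-antisym (≤′ a≡a′) (≥′ (sym a≡a′)))
      where a≡a′ = ≤-antisym a≤a′ a′≤a

-- Preorder numbering of a parking tree

AllPairs-compare : ∀ {A : Set} {R : A → A → Set} {xs x y} → AllPairs R xs → x ∈ xs → y ∈ xs → x ≡ y ⊎ (R x y ⊎ R y x)
AllPairs-compare (_ ∷ _)  (here refl) (here refl) = inj₁ refl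
AllPairs-compare (r ∷ _)  (here refl) (there y∈)  = inj₂ (inj₁ (All.lookup r y∈))
AllPairs-compare (r ∷ _)  (there x∈)  (here refl) = inj₂ (inj₂ (All.lookup r x∈))
AllPairs-compare (_ ∷ rs) (there x∈)  (there y∈)  = AllPairs-compare rs x∈ y∈

Unique-map-injective : ∀ {A B : Set} (f : A → B) {xs x y} → Unique (map f xs) → x ∈ xs → y ∈ xs → f x ≡ f y → x ≡ y
Unique-map-injective f unique x∈ y∈ fx≡fy with AllPairs-compare (AllPairs.map⁻ unique) x∈ y∈
... | inj₁ x≡y = x≡y
... | inj₂ (inj₁ fx≢fy) = contradiction fx≡fy fx≢fy
... | inj₂ (inj₂ fy≢fx) = contradiction (sym fx≡fy) fy≢fx

mutual
  -- The alternative separates the root of `t`, whose parent `p` is outside, from its other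
  -- vertices, whose parents are numbered within `t`.
  verts-range : ∀ w p t → All (λ (u , q , l) → (w ≤ u × u < w + size t) × ((q ≡ p × l ≡ labelOf t) ⊎ w ≤ q)) (verts w p t)
  verts-range w p (node l ts) = ((≤-refl , m<m+n w (s≤s z≤n)) , inj₁ (refl , refl)) ∷
    All.map (λ ((w<u , u<) , q) → (<⇒≤ w<u , ≤-trans u< (≤-reflexive (sym (+-suc w (sizeF ts))))) ,
                                  inj₂ ([ ≤-reflexive ∘ sym ∘ proj₁ , <⇒≤ ]′ q))
            (vertsF-range (suc w) w ts)

  vertsF-range : ∀ w p ts → All (λ (u , q , l) → (w ≤ u × u < w + sizeF ts) × ((q ≡ p × l ∈ map labelOf ts) ⊎ w ≤ q)) (vertsF w p ts)
  vertsF-range w p [] = []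
  vertsF-range w p (t ∷ ts) = All.++⁺
    (All.map (λ ((w≤u , u<) , q) → (w≤u , ≤-trans u< (≤-trans (m≤m+n _ (sizeF ts)) (≤-reflexive (+-assoc w (size t) (sizeF ts))))) ,
                                   [ (λ (q≡p , l≡) → inj₁ (q≡p , here l≡)) , inj₂ ]′ q)
             (verts-range w p t))
    (All.map (λ ((w≤u , u<) , q) → (≤-trans (m≤m+n w (size t)) w≤u , ≤-trans u< (≤-reflexive (+-assoc w (size t) (sizeF ts)))) ,
                                   [ (λ (q≡p , l∈) → inj₁ (q≡p , there l∈)) , (λ w≤q → inj₂ (≤-trans (m≤m+n w (size t)) w≤q)) ]′ q)
             (vertsF-range (w + size t) p ts))

mutual
  length-verts : ∀ w p t → length (verts w p t) ≡ size t
  length-verts w p (node l ts) = cong suc (length-vertsF (suc w) w ts)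

  length-vertsF : ∀ w p ts → length (vertsF w p ts) ≡ sizeF ts
  length-vertsF w p [] = refl
  length-vertsF w p (t ∷ ts) = trans (length-++ (verts w p t)) (cong₂ _+_ (length-verts w p t) (length-vertsF (w + size t) p ts))

mutual
  verts-at : ∀ w p t u → w ≤ u → u < w + size t → ∃ λ q → ∃ λ l → (u , q , l) ∈ verts w p t
  verts-at w p (node l ts) u w≤u u< with m≤n⇒m<n∨m≡n w≤u
  ... | inj₂ refl = p , l , here refl
  ... | inj₁ w<u with vertsF-at (suc w) w ts u w<u (≤-trans u< (≤-reflexive (+-suc w (sizeF ts))))
  ...   | q , l , e∈ = q , l , there e∈

  vertsF-at : ∀ w p ts u → w ≤ u → u < w + sizeF ts → ∃ λ q → ∃ λ l → (u , q , l) ∈ vertsF w p ts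
  vertsF-at w p [] u w≤u u< = contradiction w≤u (<⇒≱ (subst (u <_) (+-identityʳ w) u<))
  vertsF-at w p (t ∷ ts) u w≤u u< with <-≤-connex u (w + size t)
  ... | inj₁ u<t with verts-at w p t u w≤u u<t
  ...   | q , l , e∈ = q , l , ∈-++⁺ˡ e∈
  vertsF-at w p (t ∷ ts) u w≤u u< | inj₂ t≤u
    with vertsF-at (w + size t) p ts u t≤u (≤-trans u< (≤-reflexive (sym (+-assoc w (size t) (sizeF ts)))))
  ...   | q , l , e∈ = q , l , ∈-++⁺ʳ (verts w p t) e∈

-- The order conditions of `Stepping` for a pair of vertex records, in a form that can be proved
-- along the preorder list.
Before : Vtx → Vtx → Set
Before (w , p , l) (u , q , l′) = w < u × (q < w → q ≤ p) × (p ≡ q → proj₁ l′ ≤ proj₁ l)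

Descending : List (ℕ × ℕ) → Set
Descending = AllPairs λ l l′ → proj₁ l′ ≤ proj₁ l

childrenOK⇒descending : ∀ {d ts} → ChildrenOK d ts → Descending (map labelOf ts)
childrenOK⇒descending {ts = ts} (_ , _ , ordered) = descending (map labelOf ts) ordered
  where
  descending : ∀ ls → (∀ p q → proj₁ (lookup ls p) < proj₁ (lookup ls q) → toℕ q < toℕ p) → Descending ls
  descending [] _ = []
  descending (l ∷ ls) ord = All.tabulate (λ {l′} l′∈ → ≮⇒≥ λ l<l′ →
      contradiction (ord fzero (fsuc (index l′∈)) (subst (λ e → proj₁ l < proj₁ e) (lookup-index l′∈) l<l′)) λ ())
    ∷ descending ls λ p q lt → ≤-pred (ord (fsuc p) (fsuc q) lt)

mutual
  verts-parent-below : ∀ {w p} t → p < w → All (λ (u , q , _) → q < u) (verts w p t)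
  verts-parent-below {w} (node l ts) p<w = p<w ∷ vertsF-parent-below ts ≤-refl

  vertsF-parent-below : ∀ {w p} ts → p < w → All (λ (u , q , _) → q < u) (vertsF w p ts)
  vertsF-parent-below [] p<w = []
  vertsF-parent-below {w} (t ∷ ts) p<w =
    All.++⁺ (verts-parent-below t p<w) (vertsF-parent-below ts (<-≤-trans p<w (m≤m+n w (size t))))

mutual
  verts-before : ∀ {d w p} t → p < w → AllNodes (ChildrenOK d) t → AllPairs Before (verts w p t)
  verts-before {d} {w} {p} (node l ts) p<w (ok , oks) =
    -- Against a descendant of the root the last two conditions are vacuous, because the
    -- descendant's parent has number at least `w > p`.
    All.map (λ ((w<u , _) , q) → w<u , (λ q<w → contradiction (w≤parent q) (<⇒≱ q<w)) ,
                                 (λ p≡q → contradiction (w≤parent q) (<⇒≱ (subst (_< w) p≡q p<w))))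
            (vertsF-range (suc w) w ts)
    ∷ vertsF-before ts ≤-refl (childrenOK⇒descending {ts = ts} ok) oks
    where
    w≤parent : ∀ {q} {A : Set} → (q ≡ w × A) ⊎ w < q → w ≤ q
    w≤parent = [ ≤-reflexive ∘ sym ∘ proj₁ , <⇒≤ ]′

  vertsF-before : ∀ {d w p} ts → p < w → Descending (map labelOf ts) → AllNodesF (ChildrenOK d) ts → AllPairs Before (vertsF w p ts)
  vertsF-before [] p<w desc oks = []
  vertsF-before {d} {w} {p} (t ∷ ts) p<w (l≥ ∷ desc) (ok , oks) =
    AllPairs.++⁺ (verts-before t p<w ok) (vertsF-before ts (<-≤-trans p<w (m≤m+n w (size t))) desc oks)
      (All.zipWith (λ (r₁ , q<u) → All.map (λ r₂ → cross r₁ q<u r₂) (vertsF-range (w + size t) p ts))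
                   (verts-range w p t , verts-parent-below t p<w))
    where
    -- The parent of a vertex in a later tree is either `p`, which is at most every parent number in
    -- `t`, or a vertex numbered after all of `t`.
    cross : ∀ {u₁ q₁ l₁ u₂ q₂ l₂} →
            (w ≤ u₁ × u₁ < w + size t) × ((q₁ ≡ p × l₁ ≡ labelOf t) ⊎ w ≤ q₁) → q₁ < u₁ →
            (w + size t ≤ u₂ × u₂ < w + size t + sizeF ts) × ((q₂ ≡ p × l₂ ∈ map labelOf ts) ⊎ w + size t ≤ q₂) →
            Before (u₁ , q₁ , l₁) (u₂ , q₂ , l₂)
    cross {u₁} {q₁} {l₁} {u₂} {q₂} {l₂} ((_ , u₁<) , q₁∈) q₁<u₁ ((≤u₂ , _) , q₂∈) = <-≤-trans u₁< ≤u₂ , nested q₂∈ , siblings q₁∈ q₂∈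
      where
      nested : (q₂ ≡ p × l₂ ∈ map labelOf ts) ⊎ w + size t ≤ q₂ → q₂ < u₁ → q₂ ≤ q₁
      nested (inj₁ (refl , _)) _ = [ ≤-reflexive ∘ sym ∘ proj₁ , ≤-trans (<⇒≤ p<w) ]′ q₁∈
      nested (inj₂ ≤q₂) q₂<u₁ = contradiction (<-≤-trans u₁< ≤q₂) (<-asym q₂<u₁)

      siblings : (q₁ ≡ p × l₁ ≡ labelOf t) ⊎ w ≤ q₁ → (q₂ ≡ p × l₂ ∈ map labelOf ts) ⊎ w + size t ≤ q₂ →
                 q₁ ≡ q₂ → proj₁ l₂ ≤ proj₁ l₁
      siblings (inj₁ (_ , refl)) (inj₁ (_ , l₂∈)) _ = All.lookup l≥ l₂∈
      siblings (inj₂ w≤q₁) (inj₁ (refl , _)) refl = contradiction w≤q₁ (<⇒≱ p<w)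
      siblings _ (inj₂ ≤q₂) refl = contradiction q₁<u₁ (<-asym (<-≤-trans u₁< ≤q₂))

-- Recovering siblings from the list of vertices

vertsF-roots : ∀ w p ts {l} → l ∈ map labelOf ts → ∃ λ u → (u , p , l) ∈ vertsF w p ts
vertsF-roots w p (node _ _ ∷ ts) (here refl) = w , here refl
vertsF-roots w p (t ∷ ts) (there l∈) with vertsF-roots (w + size t) p ts l∈
... | u , e∈ = u , ∈-++⁺ʳ (verts w p t) e∈

-- Restores, from a flat list of records, the list of children containing a given vertex, so that a
-- condition such as `ChildrenOK` becomes available for it.
SiblingGroup : (List PTree → Set) → List Vtx → ℕ → ℕ × ℕ → Set
SiblingGroup P vs q l = ∃ λ ts → P ts × l ∈ map labelOf ts × (∀ {l′} → l′ ∈ map labelOf ts → ∃ λ u → (u , q , l′) ∈ vs)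

siblingGroup-map : ∀ {P vs vs′ q l} → (∀ {e} → e ∈ vs → e ∈ vs′) → SiblingGroup P vs q l → SiblingGroup P vs′ q l
siblingGroup-map vs⊆vs′ (ts , ok , l∈ , siblings) = ts , ok , l∈ , λ l′∈ → proj₁ (siblings l′∈) , vs⊆vs′ (proj₂ (siblings l′∈))

mutual
  verts-siblings : ∀ {P u q l} w p t → AllNodes P t → (u , q , l) ∈ verts w p t →
                   (q ≡ p × l ≡ labelOf t) ⊎ SiblingGroup P (verts w p t) q l
  verts-siblings w p (node _ ts) (ok , oks) (here refl) = inj₁ (refl , refl)
  verts-siblings w p (node _ ts) (ok , oks) (there e∈) with vertsF-siblings (suc w) w ts oks e∈
  ... | inj₁ (refl , l∈) = inj₂ (ts , ok , l∈ , λ l′∈ → proj₁ (vertsF-roots (suc w) w ts l′∈) , there (proj₂ (vertsF-roots (suc w) w ts l′∈)))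
  ... | inj₂ group = inj₂ (siblingGroup-map there group)

  vertsF-siblings : ∀ {P u q l} w p ts → AllNodesF P ts → (u , q , l) ∈ vertsF w p ts →
                    (q ≡ p × l ∈ map labelOf ts) ⊎ SiblingGroup P (vertsF w p ts) q l
  vertsF-siblings w p (t ∷ ts) (ok , oks) e∈ with ∈-++⁻ (verts w p t) e∈
  ... | inj₁ e∈t with verts-siblings w p t ok e∈t
  ...   | inj₁ (q≡p , l≡) = inj₁ (q≡p , here l≡)
  ...   | inj₂ group = inj₂ (siblingGroup-map ∈-++⁺ˡ group)
  vertsF-siblings w p (t ∷ ts) (ok , oks) e∈ | inj₂ e∈ts with vertsF-siblings (w + size t) p ts oks e∈ts
  ...   | inj₁ (q≡p , l∈) = inj₁ (q≡p , there l∈)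
  ...   | inj₂ group = inj₂ (siblingGroup-map (∈-++⁺ʳ (verts w p t)) group)

module ParkingTree {d k F} (tree : IsParkingTree d k F) {a : Fin k → ℕ} (a-entry : ∀ i → AEntry F (suc (toℕ i)) (a i)) where

  private
    labels-in-range : All (λ v → InRange d k (vlabel v)) (nonRoot F)
    labels-in-range = proj₁ (proj₂ tree)

    labels-unique : Unique (map vlabel (nonRoot F))
    labels-unique = proj₁ (proj₂ (proj₂ tree))

    rootOK : ChildrenOK d F
    rootOK = proj₁ (proj₂ (proj₂ (proj₂ tree)))

    nodesOK : AllNodesF (ChildrenOK d) F
    nodesOK = proj₂ (proj₂ (proj₂ (proj₂ tree)))

    sizeF≡ : sizeF F ≡ d * k
    sizeF≡ = trans (sym (length-vertsF 2 1 F)) (proj₁ tree)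

  -- `AEntry` mentions only the label i_1. The condition on consecutive siblings puts the remaining
  -- labels of the group right after it, under the same parent.
  entry : ∀ (i : Fin k) (j : Fin d) → ∃ λ u → (u , a i , (suc (toℕ i) , suc (toℕ j))) ∈ nonRoot F
  entry i j with vertsF-siblings 2 1 F nodesOK (proj₂ (a-entry i))
  ... | inj₁ (ai≡1 , l∈) with proj₁ (proj₂ rootOK) (index l∈) (suc (toℕ i)) (sym (lookup-index l∈)) (toℕ j) (Fin.toℕ<n j)
  ...   | q , _ , l≡ with vertsF-roots 2 1 F (∈-lookup q)
  ...     | u , e∈ = u , subst₂ (λ p l → (u , p , l) ∈ nonRoot F) (sym ai≡1) l≡ e∈
  entry i j | inj₂ (ts , ok , l∈ , siblings)
    with proj₁ (proj₂ ok) (index l∈) (suc (toℕ i)) (sym (lookup-index l∈)) (toℕ j) (Fin.toℕ<n j)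
  ...   | q , _ , l≡ with siblings (∈-lookup q)
  ...     | u , e∈ = u , subst (λ l → (u , a i , l) ∈ nonRoot F) l≡ e∈

  -- Labels occur once, so the record is the one found by `entry` for its label, and its parent is
  -- `a i`.
  vertex : ∀ {u q l} → (u , q , l) ∈ nonRoot F →
           ∃ λ (y : Fin (d * k)) → ∃ λ i → ∃ λ (j : Fin d) → u ≡ 2 + toℕ y × q ≡ a i × l ≡ (suc (toℕ i) , suc (toℕ j))
  vertex {suc (suc u)} {q} {suc i , suc j} e∈ with All.lookup labels-in-range e∈ | All.lookup (vertsF-range 2 1 F) e∈
  ... | (_ , i<k) , (_ , j<d) | (_ , s≤s (s≤s u<)) , _ =
    fromℕ< u<dk , fromℕ< i<k , fromℕ< j<d , cong (suc ∘ suc) (sym (Fin.toℕ-fromℕ< u<dk)) ,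
    cong (proj₁ ∘ proj₂) (Unique-map-injective vlabel labels-unique e∈ (proj₂ (entry (fromℕ< i<k) (fromℕ< j<d))) (sym l≡)) , sym l≡
    where
    u<dk : u < d * k
    u<dk = subst (u <_) sizeF≡ u<
    l≡ : (suc (toℕ (fromℕ< i<k)) , suc (toℕ (fromℕ< j<d))) ≡ (suc i , suc j)
    l≡ = cong₂ (λ i j → suc i , suc j) (Fin.toℕ-fromℕ< i<k) (Fin.toℕ-fromℕ< j<d)
  vertex {zero} e∈ with All.lookup (vertsF-range 2 1 F) e∈
  ... | (() , _) , _
  vertex {suc zero} e∈ with All.lookup (vertsF-range 2 1 F) e∈
  ... | (s≤s () , _) , _
  vertex {l = zero , _} e∈ with All.lookup labels-in-range e∈
  ... | (() , _) , _
  vertex {l = suc _ , zero} e∈ with All.lookup labels-in-range e∈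
  ... | _ , (() , _)

  before : ∀ {e e′} → e ∈ nonRoot F → e′ ∈ nonRoot F → e ≡ e′ ⊎ (Before e e′ ⊎ Before e′ e)
  before = AllPairs-compare (vertsF-before F ≤-refl (childrenOK⇒descending {ts = F} rootOK) nodesOK)

  sameNumber : ∀ {u q q′ l l′} → (u , q , l) ∈ nonRoot F → (u , q′ , l′) ∈ nonRoot F → l ≡ l′
  sameNumber e∈ e′∈ with before e∈ e′∈
  ... | inj₁ refl = refl
  ... | inj₂ (inj₁ (u<u , _)) = contradiction u<u (<-irrefl refl)
  ... | inj₂ (inj₂ (u<u , _)) = contradiction u<u (<-irrefl refl)

  vertexAt : ∀ (y : Fin (d * k)) → ∃ λ i → ∃ λ (j : Fin d) → (2 + toℕ y , a i , (suc (toℕ i) , suc (toℕ j))) ∈ nonRoot F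
  vertexAt y with vertsF-at 2 1 F (2 + toℕ y) (s≤s (s≤s z≤n)) (s≤s (s≤s (subst (toℕ y <_) (sym sizeF≡) (Fin.toℕ<n y))))
  ... | q , l , e∈ with vertex e∈
  ...   | _ , i , j , _ , refl , refl = i , j , e∈

  stepOf : Fin (d * k) → Fin k
  stepOf = proj₁ ∘ vertexAt

  vertexOf : Fin k → Fin d → Fin (d * k)
  vertexOf i j = proj₁ (vertex (proj₂ (entry i j)))

  entryAt : ∀ y → ∃ λ (j : Fin d) → (2 + toℕ y , a (stepOf y) , (suc (toℕ (stepOf y)) , suc (toℕ j))) ∈ nonRoot F
  entryAt = proj₂ ∘ vertexAt

  vertexOf-entry : ∀ i j → (2 + toℕ (vertexOf i j) , a i , (suc (toℕ i) , suc (toℕ j))) ∈ nonRoot F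
  vertexOf-entry i j with entry i j
  ... | u , e∈ with vertex e∈
  ...   | y , _ , _ , refl , _ = e∈

  stepOf-entry : ∀ {y q i j} → (2 + toℕ y , q , (suc (toℕ i) , j)) ∈ nonRoot F → stepOf y ≡ i
  stepOf-entry {y} e∈ = Fin.toℕ-injective (suc-injective (cong proj₁ (sameNumber (proj₂ (entryAt y)) e∈)))

  stepping : Stepping d a stepOf
  stepping = record
    { parent-below = λ y → All.lookup (vertsF-parent-below F ≤-refl) (proj₂ (entryAt y))
    ; nested = λ {w} {u} w<u → proj₁ (proj₂ (beforeAt w u w<u))
    ; siblings-desc = λ {w} {u} w<u au≡aw → ≤-pred (proj₂ (proj₂ (beforeAt w u w<u)) (sym au≡aw))
    -- The vertices of step `i` are enumerated bijectively by the second index `j` of their labels.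
    ; step-size = λ i → count-image (λ y → stepOf y Fin.≟ i) (vertexOf i) (vertexOf-injective i)
        (λ j → stepOf-entry (vertexOf-entry i j)) (λ { y refl → vertexOf-surjective y })
    }
    where
    record-at : Fin (d * k) → Vtx
    record-at y = 2 + toℕ y , a (stepOf y) , (suc (toℕ (stepOf y)) , suc (toℕ (proj₁ (entryAt y))))

    beforeAt : ∀ w u → toℕ w < toℕ u → Before (record-at w) (record-at u)
    beforeAt w u w<u with before (proj₂ (entryAt w)) (proj₂ (entryAt u))
    ... | inj₁ eq = contradiction w<u (<-irrefl (suc-injective (suc-injective (cong proj₁ eq))))
    ... | inj₂ (inj₁ b) = b
    ... | inj₂ (inj₂ (u<w , _)) = contradiction (≤-pred (≤-pred u<w)) (<-asym w<u)

    vertexOf-injective : ∀ i {j j′} → vertexOf i j ≡ vertexOf i j′ → j ≡ j′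
    vertexOf-injective i {j} {j′} eq = Fin.toℕ-injective (suc-injective (cong proj₂
      (sameNumber (vertexOf-entry i j) (subst (λ y → (2 + toℕ y , _ , _) ∈ nonRoot F) (sym eq) (vertexOf-entry i j′)))))

    vertexOf-surjective : ∀ y → ∃ λ j → vertexOf (stepOf y) j ≡ y
    vertexOf-surjective y with entryAt y
    ... | j , e∈ = j , Fin.toℕ-injective (suc-injective (suc-injective (cong proj₁
      (Unique-map-injective vlabel labels-unique (vertexOf-entry (stepOf y) j) e∈ refl))))

-- Maximal chains

chain-≤ₚ : ∀ {n k} (π : Fin (suc k) → Partition n) → (∀ i → π (inject₁ i) ≤ₚ π (fsuc i)) →
           ∀ i j → toℕ i ≤ toℕ j → π i ≤ₚ π j
chain-≤ₚ π step fzero fzero _ x y x∼y = x∼y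
chain-≤ₚ {k = suc k} π step fzero (fsuc j) _ x y x∼y = chain-≤ₚ (π ∘ fsuc) (step ∘ fsuc) fzero j z≤n x y (step fzero x y x∼y)
chain-≤ₚ {k = suc k} π step (fsuc i) (fsuc j) (s≤s i≤j) = chain-≤ₚ (π ∘ fsuc) (step ∘ fsuc) i j i≤j

exit : ∀ {k} {P : Fin (suc k) → Set} → Decidable P → P fzero → ¬ P (fromℕ k) → ∃ λ i → P (inject₁ i) × ¬ P (fsuc i)
exit {zero} P? p ¬p = contradiction p ¬p
exit {suc k} P? p ¬p with P? (fsuc fzero)
... | no ¬p₁ = fzero , p , ¬p₁
... | yes p₁ with exit (P? ∘ fsuc) p₁ ¬p
...   | i , pi , ¬pi = fsuc i , pi , ¬pi

descent : ∀ {d k} (f : Fin (suc k) → ℕ) → (∀ i → d + f (fsuc i) ≤ f (inject₁ i)) → k * d + f (fromℕ k) ≤ f fzero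
descent {k = zero} f drop = ≤-refl
descent {d} {suc k} f drop = begin
  d + k * d + f (fromℕ (suc k))   ≡⟨ +-assoc d (k * d) _ ⟩
  d + (k * d + f (fromℕ (suc k))) ≤⟨ +-monoʳ-≤ d (descent (f ∘ fsuc) (drop ∘ fsuc)) ⟩
  d + f (fsuc fzero)              ≤⟨ drop fzero ⟩
  f fzero                         ∎
  where open ≤-Reasoning

-- If `k` drops of at least `d` add up to at most `k * d`, none of them can exceed `d`.
descent-tight : ∀ {d k} (f : Fin (suc k) → ℕ) → (∀ i → d + f (fsuc i) ≤ f (inject₁ i)) → f fzero ≤ k * d + f (fromℕ k) →
                ∀ i → f (inject₁ i) ≡ d + f (fsuc i)
descent-tight {d} {suc k} f drop tight fzero = ≤-antisym (begin
  f fzero                         ≤⟨ tight ⟩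
  d + k * d + f (fromℕ (suc k))   ≡⟨ +-assoc d (k * d) _ ⟩
  d + (k * d + f (fromℕ (suc k))) ≤⟨ +-monoʳ-≤ d (descent (f ∘ fsuc) (drop ∘ fsuc)) ⟩
  d + f (fsuc fzero)              ∎) (drop fzero)
  where open ≤-Reasoning
descent-tight {d} {suc k} f drop tight (fsuc i) = descent-tight (f ∘ fsuc) (drop ∘ fsuc)
  (+-cancelˡ-≤ d _ _ (≤-trans (drop fzero) (≤-trans tight (≤-reflexive (+-assoc d (k * d) _))))) i

module Chain {d k} (π : Fin (suc k) → Partition (suc (d * k))) (chain : MaximalChainNCd d k π)
             {a : Fin k → ℕ} (label : ∀ i → IsLabel (π (inject₁ i)) (π (fsuc i)) (a i)) where

  private
    inNC : ∀ i → InNCd d (π i)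
    inNC = proj₁ chain

    bottom : IsBottom (π fzero)
    bottom = proj₁ (proj₂ chain)

    top : IsTop (π (fromℕ k))
    top = proj₁ (proj₂ (proj₂ chain))

    cover-≤ : ∀ i → π (inject₁ i) ≤ₚ π (fsuc i)
    cover-≤ i = proj₁ (proj₂ (proj₂ (proj₂ (proj₂ (proj₂ chain)) i)))

    cover-≰ : ∀ i → ¬ (π (fsuc i) ≤ₚ π (inject₁ i))
    cover-≰ i = proj₁ (proj₂ (proj₂ (proj₂ (proj₂ (proj₂ (proj₂ chain)) i))))

    module Cover i = Refinement (inNC (inject₁ i)) (inNC (fsuc i)) (cover-≤ i)

  mono : ∀ {i j} → toℕ i ≤ toℕ j → π i ≤ₚ π j
  mono {i} {j} = chain-≤ₚ π cover-≤ i j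

  NewAt : Fin k → Fin (suc (d * k)) → Set
  NewAt i = New (π (inject₁ i)) (π (fsuc i))

  newAt? : ∀ i → Decidable (NewAt i)
  newAt? i = new? (π (inject₁ i)) (π (fsuc i))

  minima : Fin (suc k) → ℕ
  minima i = count (isMin? (π i))

  minima-bottom : minima fzero ≡ suc (d * k)
  minima-bottom = trans (count-cong (isMin? (π fzero)) (λ _ → yes tt) (λ _ _ → tt)
                                    (λ x _ y x∼y → ≤-reflexive (cong toℕ (bottom x y x∼y))))
                        (count-all (suc (d * k)))

  minima-top : minima (fromℕ k) ≡ 1
  minima-top = count-unique (isMin? (π (fromℕ k))) fzero (λ _ _ → z≤n)
    λ y ymin → Fin.toℕ-injective (n≤0⇒n≡0 (ymin fzero (top y fzero)))

  -- The number of blocks falls from dk+1 to 1 in `k` steps, each time by a positive multiple of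
  -- `d`.
  count-newAt : ∀ i → count (newAt? i) ≡ d
  count-newAt i = +-cancelˡ-≡ (minima (fsuc i)) _ d (begin
    minima (fsuc i) + count (newAt? i)  ≡⟨ Cover.count-minima i ⟨
    minima (inject₁ i)                  ≡⟨ descent-tight minima drop tight i ⟩
    d + minima (fsuc i)                 ≡⟨ +-comm d _ ⟩
    minima (fsuc i) + d                 ∎)
    where
    open ≡-Reasoning
    drop : ∀ i → d + minima (fsuc i) ≤ minima (inject₁ i)
    drop i = subst (d + minima (fsuc i) ≤_) (sym (trans (Cover.count-minima i) (+-comm _ (count (newAt? i)))))
      (+-monoˡ-≤ (minima (fsuc i)) (∣-positive⇒≤ (Cover.∣-count-new i) (Cover.new-exists i (cover-≰ i))))

    tight : minima fzero ≤ k * d + minima (fromℕ k)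
    tight = ≤-reflexive (trans minima-bottom (sym (trans (cong (k * d +_) minima-top)
              (trans (+-comm (k * d) 1) (cong suc (*-comm k d))))))

  module Label i = Cover.Merge.Label i (count-newAt i) (label i)
  open Label public using (m₁; p)

  p∼later : ∀ {i j x} → NewAt i x → suc (toℕ i) ≤ toℕ j → SameBlock (π j) (p i) x
  p∼later {i} {j} {x} xnew i<j = mono {fsuc i} {j} i<j (p i) x (Label.p∼new i xnew)

  newAt-index : ∀ {i j x} → NewAt i x → NewAt j x → toℕ i ≤ toℕ j
  newAt-index {i} {j} {x} (xmin , _) (_ , ¬xmin) = ≮⇒≥ λ j<i →
    ¬xmin (isMin-antitone {π = π (fsuc j)} {π (inject₁ i)} (mono (subst (suc (toℕ j) ≤_) (sym (Fin.toℕ-inject₁ i)) j<i)) xmin)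

  newAt-unique : ∀ {i j x} → NewAt i x → NewAt j x → i ≡ j
  newAt-unique inew jnew = Fin.toℕ-injective (≤-antisym (newAt-index inew jnew) (newAt-index jnew inew))

  -- All elements are minimal in the bottom partition and only the first one in the top partition,
  -- so `fsuc y` ceases to be minimal at some cover.
  joinStep : ∀ y → ∃ λ i → NewAt i (fsuc y)
  joinStep y = exit (λ i → isMin? (π i) (fsuc y)) (λ z y∼z → ≤-reflexive (cong toℕ (bottom (fsuc y) z y∼z)))
    λ ymin → case (ymin fzero (top (fsuc y) fzero)) of λ ()

  joinAt : Fin (d * k) → Fin k
  joinAt y = proj₁ (joinStep y)

  joinAt-new : ∀ y → NewAt (joinAt y) (fsuc y)
  joinAt-new y = proj₂ (joinStep y)

  nc : ∀ i {x y z w} → toℕ x < toℕ y → toℕ y < toℕ z → toℕ z < toℕ w →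
       SameBlock (π i) x z → SameBlock (π i) y w → SameBlock (π i) x y
  nc i = noncrossing (π i) (proj₁ (inNC i))

  -- The arcs from `p i′` to `x′` and from `p i` to `x` would cross. At the later of the two steps
  -- the other arc already lies inside one block, and noncrossingness after that step puts all four
  -- points into one block.
  module _ {i′ i x′ x} (new′ : NewAt i′ x′) (new : NewAt i x)
           (p′<p : toℕ (p i′) < toℕ (p i)) (p<x′ : toℕ (p i) < toℕ x′) (x′<x : toℕ x′ < toℕ x) where

    private
      -- The arc of step `i` is the older one. If its block is the first block at step `i′`, then
      -- `p i` lies between the label and the new element `x′`; otherwise `x′` lies in a gap of a
      -- later block.
      earlier : toℕ i < toℕ i′ → ⊥
      earlier i<i′ = byFirst (π (inject₁ i′) (m₁ i′) ≟ π (inject₁ i′) (p i))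
        where
        p∼x : SameBlock (π (inject₁ i′)) (p i) x
        p∼x = p∼later new (subst (suc (toℕ i) ≤_) (sym (Fin.toℕ-inject₁ i′)) i<i′)

        p′∼p : SameBlock (π (fsuc i′)) (p i′) (p i)
        p′∼p = nc (fsuc i′) {p i′} {p i} {x′} {x} p′<p p<x′ x′<x (Label.p∼new i′ new′) (cover-≤ i′ (p i) x p∼x)

        byFirst : Dec (SameBlock (π (inject₁ i′)) (m₁ i′) (p i)) → ⊥
        byFirst (yes m₁∼p) = Label.first-gap i′ {p i} {x′} new′ m₁∼p p′<p p<x′
        byFirst (no m₁≁p) = Label.other-gap i′ {p i} {x} {x′} new′ p∼x (trans (sym p′∼p) (Label.p∼new i′ new′)) (m₁≁p ∘ sym) p<x′ x′<x

      -- The arc of step `i′` is the older one. If its block is the first block at step `i`, then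
      -- `x′` lies between the label and the new element `x`; otherwise it crosses the pair `m₁ i`,
      -- `p i`.
      later : toℕ i′ < toℕ i → ⊥
      later i′<i = byFirst (π (inject₁ i) (m₁ i) ≟ π (inject₁ i) (p i′))
        where
        p′∼x′ : SameBlock (π (inject₁ i)) (p i′) x′
        p′∼x′ = p∼later new′ (subst (suc (toℕ i′) ≤_) (sym (Fin.toℕ-inject₁ i)) i′<i)

        p′∼p : SameBlock (π (fsuc i)) (p i′) (p i)
        p′∼p = nc (fsuc i) {p i′} {p i} {x′} {x} p′<p p<x′ x′<x (cover-≤ i (p i′) x′ p′∼x′) (Label.p∼new i new)

        m₁∼p : SameBlock (π (fsuc i)) (m₁ i) (p i)
        m₁∼p = cover-≤ i (m₁ i) (p i) (Label.m₁∼p i)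

        first≤ : toℕ (m₁ i) ≤ toℕ (p i′)
        first≤ = Label.m₁-minσ i (p i′) (trans m₁∼p (sym p′∼p))

        byFirst : Dec (SameBlock (π (inject₁ i)) (m₁ i) (p i′)) → ⊥
        byFirst (yes m₁∼p′) = Label.first-gap i {x′} {x} new (trans m₁∼p′ p′∼x′) p<x′ x′<x
        byFirst (no m₁≁p′) = m₁≁p′ (nc (inject₁ i) {m₁ i} {p i′} {p i} {x′}
          (≤∧≢⇒< first≤ λ m₁≡p′ → m₁≁p′ (cong (π (inject₁ i)) (Fin.toℕ-injective m₁≡p′)))
          p′<p p<x′ (Label.m₁∼p i) p′∼x′)

      simultaneous : toℕ i ≡ toℕ i′ → ⊥
      simultaneous i≡i′ = <-irrefl (cong (λ i → toℕ (p i)) (sym (Fin.toℕ-injective i≡i′))) p′<p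

    noCrossing : ⊥
    noCrossing = [ (λ i≤i′ → [ earlier , simultaneous ]′ (m≤n⇒m<n∨m≡n i≤i′)) , later ]′ (≤-<-connex (toℕ i) (toℕ i′))

  stepping : Stepping d a joinAt
  stepping = record
    { parent-below = λ y → subst (_< 2 + toℕ y) (sym (Label.label≡ (joinAt y))) (s≤s (Label.label-below (joinAt y) (joinAt-new y)))
    ; nested = λ {w} {u} → nested w u
    ; siblings-desc = λ {w} {u} → siblings-desc w u
    ; step-size = λ i → trans (sym (step-size i)) (count-newAt i)
    }
    where
    nested : ∀ w u → toℕ w < toℕ u → a (joinAt u) < 2 + toℕ w → a (joinAt u) ≤ a (joinAt w)
    nested w u w<u au<w = ≮⇒≥ λ aw<au → noCrossing (joinAt-new w) (joinAt-new u)
      (≤-pred (subst₂ _<_ (Label.label≡ (joinAt w)) (Label.label≡ (joinAt u)) aw<au))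
      (≤-pred (subst (_< 2 + toℕ w) (Label.label≡ (joinAt u)) au<w)) (s≤s w<u)

    siblings-desc : ∀ w u → toℕ w < toℕ u → a (joinAt u) ≡ a (joinAt w) → toℕ (joinAt u) ≤ toℕ (joinAt w)
    -- Had `w` been joined first, it would be an element of the first block between the label and
    -- the new element `u`.
    siblings-desc w u w<u au≡aw = ≮⇒≥ λ jw<ju → Label.first-gap i {fsuc w} {fsuc u} (joinAt-new u)
      (trans (Label.m₁∼p i) (trans (cong (π (inject₁ i)) p≡p′)
        (p∼later (joinAt-new w) (subst (suc (toℕ (joinAt w)) ≤_) (sym (Fin.toℕ-inject₁ i)) jw<ju))))
      (subst (λ q → toℕ q < suc (toℕ w)) (sym p≡p′) (Label.label-below (joinAt w) (joinAt-new w))) (s≤s w<u)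
      where
      i = joinAt u
      p≡p′ : p i ≡ p (joinAt w)
      p≡p′ = Fin.toℕ-injective (suc-injective (trans (sym (Label.label≡ i)) (trans au≡aw (Label.label≡ (joinAt w)))))

    step-size : ∀ i → count (newAt? i) ≡ count (λ y → joinAt y Fin.≟ i)
    -- The element 1 is never new, so the count may skip it and run over the non-root vertices.
    step-size i = trans (count-fsuc (newAt? i) λ (_ , ¬min) → ¬min λ _ _ → z≤n)
      (count-cong (newAt? i ∘ fsuc) (λ y → joinAt y Fin.≟ i) (λ y → newAt-unique (joinAt-new y)) λ { y refl → joinAt-new y })

-- Components of the tree are blocks of the chain

module ChainFromTree {d k} (π : Fin (suc k) → Partition (suc (d * k))) (chain : MaximalChainNCd d k π)
                     {F} (tree : IsParkingTree d k F) {a : Fin k → ℕ} (a-entry : ∀ i → AEntry F (suc (toℕ i)) (a i))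
                     (label : ∀ i → IsLabel (π (inject₁ i)) (π (fsuc i)) (a i)) where

  open ParkingTree tree a-entry using (vertex; stepOf; stepOf-entry; entryAt) renaming (stepping to treeStepping)
  open Chain π chain label

  stepOf≡joinAt : ∀ y → stepOf y ≡ joinAt y
  stepOf≡joinAt = stepping-unique treeStepping stepping

  entry-new : ∀ {y q i j} → (2 + toℕ y , q , (suc (toℕ i) , j)) ∈ nonRoot F → NewAt i (fsuc y)
  entry-new {y} e∈ = subst (λ i → NewAt i (fsuc y)) (trans (sym (stepOf≡joinAt y)) (stepOf-entry e∈)) (joinAt-new y)

  new-entry : ∀ {i y} → NewAt i (fsuc y) → ∃ λ j → (2 + toℕ y , a i , (suc (toℕ i) , j)) ∈ nonRoot F
  new-entry {i} {y} ynew = suc (toℕ (proj₁ (entryAt y))) , subst (λ i → (2 + toℕ y , a i , (suc (toℕ i) , _)) ∈ nonRoot F)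
    (trans (stepOf≡joinAt y) (newAt-unique (joinAt-new y) ynew)) (proj₂ (entryAt y))

  numbers-injective : ∀ {n} {x y : Fin n} → suc (toℕ x) ≡ suc (toℕ y) → x ≡ y
  numbers-injective = Fin.toℕ-injective ∘ suc-injective

  -- Reflexive on all of ℕ, as Connected relates also the numbers outside
  -- [dk+1] to themselves.
  SameBlockω : Fin (suc k) → ℕ → ℕ → Set
  SameBlockω i u v = u ≡ v ⊎ ∃ λ x → ∃ λ y → u ≡ suc (toℕ x) × v ≡ suc (toℕ y) × SameBlock (π i) x y

  sameBlockω-isEquivalence : ∀ i → IsEquivalence (SameBlockω i)
  sameBlockω-isEquivalence i = record { refl = inj₁ refl ; sym = symω ; trans = transω }
    where
    symω : ∀ {u v} → SameBlockω i u v → SameBlockω i v u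
    symω (inj₁ refl) = inj₁ refl
    symω (inj₂ (x , y , u≡ , v≡ , x∼y)) = inj₂ (y , x , v≡ , u≡ , sym x∼y)

    transω : ∀ {u v w} → SameBlockω i u v → SameBlockω i v w → SameBlockω i u w
    transω (inj₁ refl) v∼w = v∼w
    transω u∼v (inj₁ refl) = u∼v
    transω (inj₂ (x , y , u≡ , v≡ , x∼y)) (inj₂ (y′ , z , v≡′ , w≡ , y′∼z)) =
      inj₂ (x , z , u≡ , w≡ , trans x∼y (trans (cong (π i) (numbers-injective (trans (sym v≡) v≡′))) y′∼z))

  edge⇒sameBlock : ∀ i {u v} → Edge F (toℕ i) u v → SameBlockω i u v
  edge⇒sameBlock i (j , s , (_ , j≤i) , e∈) = fromVertex j≤i e∈ (vertex e∈)
    where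
    fromVertex : ∀ {u v j s} → j ≤ toℕ i → (u , v , (j , s)) ∈ nonRoot F →
                 (∃ λ (y : Fin (d * k)) → ∃ λ i → ∃ λ (j′ : Fin d) → u ≡ 2 + toℕ y × v ≡ a i × (j , s) ≡ (suc (toℕ i) , suc (toℕ j′))) →
                 SameBlockω i u v
    fromVertex j≤i e∈ (y , i′ , _ , refl , refl , refl) =
      inj₂ (fsuc y , p i′ , refl , Label.label≡ i′ , sym (p∼later {i′} {i} (entry-new e∈) j≤i))

  connected⇒sameBlock : ∀ i x y → Connected F (toℕ i) (suc (toℕ x)) (suc (toℕ y)) → SameBlock (π i) x y
  connected⇒sameBlock i x y x∼y =
    [ cong (π i) ∘ numbers-injective
    , (λ (x′ , y′ , x≡ , y≡ , x′∼y′) → trans (cong (π i) (numbers-injective x≡)) (trans x′∼y′ (cong (π i) (sym (numbers-injective y≡)))))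
    ]′ (fold (sameBlockω-isEquivalence i) (edge⇒sameBlock i) x∼y)

  -- An element that is not minimal in its block was new at some step `j < i`. Its parent `p j` is
  -- smaller and in the same block, so ascending the tree ends at the block minimum; `b` bounds the
  -- element.
  connected-min : ∀ i b x → toℕ x < b →
                  ∃ λ m → IsMin (π i) m × SameBlock (π i) x m × Connected F (toℕ i) (suc (toℕ x)) (suc (toℕ m))
  connected-min i (suc b) x (s≤s x≤b) = byMin x x≤b (isMin? (π i) x)
    where
    byMin : ∀ x → toℕ x ≤ b → Dec (IsMin (π i) x) →
            ∃ λ m → IsMin (π i) m × SameBlock (π i) x m × Connected F (toℕ i) (suc (toℕ x)) (suc (toℕ m))
    byMin x _ (yes xmin) = x , xmin , refl , ε
    byMin fzero _ (no ¬xmin) = contradiction (λ _ _ → z≤n) ¬xmin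
    byMin (fsuc y) y<b (no ¬xmin) = m , mmin , trans (sym (p∼later {j} {i} ynew j<i)) p∼m , transitive _ (return edge) p⇝m
      where
      j = joinAt y
      ynew : NewAt j (fsuc y)
      ynew = joinAt-new y

      j<i : toℕ j < toℕ i
      j<i = ≰⇒> λ i≤j → ¬xmin (isMin-antitone {π = π i} {π (inject₁ j)}
        (mono {i} {inject₁ j} (subst (toℕ i ≤_) (sym (Fin.toℕ-inject₁ j)) i≤j)) (proj₁ ynew))

      edge : Edge F (toℕ i) (2 + toℕ y) (suc (toℕ (p j)))
      edge = suc (toℕ j) , proj₁ (new-entry ynew) , (s≤s z≤n , j<i) ,
        subst (λ q → (2 + toℕ y , q , (suc (toℕ j) , proj₁ (new-entry ynew))) ∈ nonRoot F) (Label.label≡ j) (proj₂ (new-entry ynew))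

      below : ∃ λ m → IsMin (π i) m × SameBlock (π i) (p j) m × Connected F (toℕ i) (suc (toℕ (p j))) (suc (toℕ m))
      below = connected-min i b (p j) (<-≤-trans (Label.label-below j ynew) y<b)

      m = proj₁ below
      mmin = proj₁ (proj₂ below)
      p∼m = proj₁ (proj₂ (proj₂ below))
      p⇝m = proj₂ (proj₂ (proj₂ below))

  sameBlock⇒connected : ∀ i x y → SameBlock (π i) x y → Connected F (toℕ i) (suc (toℕ x)) (suc (toℕ y))
  sameBlock⇒connected i x y x∼y = meet (connected-min i _ x ≤-refl) (connected-min i _ y ≤-refl)
    where
    ToMin : Fin (suc (d * k)) → Set
    ToMin x = ∃ λ m → IsMin (π i) m × SameBlock (π i) x m × Connected F (toℕ i) (suc (toℕ x)) (suc (toℕ m))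

    meet : ToMin x → ToMin y → Connected F (toℕ i) (suc (toℕ x)) (suc (toℕ y))
    meet (m , mmin , x∼m , x⇝m) (m′ , m′min , y∼m′ , y⇝m′) = transitive _ x⇝m
      (subst (λ m → Connected F (toℕ i) (suc (toℕ m)) (suc (toℕ y)))
        (sym (isMin-unique (π i) mmin m′min (trans (sym x∼m) (trans x∼y y∼m′)))) (symmetric _ y⇝m′))

  -- The blocks merged at a single step

  InMerged : Fin k → Fin (suc (d * k)) → Set
  InMerged i = InMergedBlocks (π (inject₁ i)) F (suc (toℕ i))

  merged⇒p∼ : ∀ i x → InMerged i x → SameBlock (π (fsuc i)) (p i) x
  merged⇒p∼ i x (z , x∼z , w , q , s , e∈ , z≡) = trans (fromVertex e∈ z≡ (vertex e∈)) (sym (mono {inject₁ i} {fsuc i} i≤1+i x z x∼z))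
    where
    i≤1+i : toℕ (inject₁ i) ≤ suc (toℕ i)
    i≤1+i = ≤-trans (≤-reflexive (Fin.toℕ-inject₁ i)) (n≤1+n _)

    fromVertex : ∀ {w q s} → (w , q , (suc (toℕ i) , s)) ∈ nonRoot F → suc (toℕ z) ≡ w ⊎ suc (toℕ z) ≡ q →
                 (∃ λ (y : Fin (d * k)) → ∃ λ i′ → ∃ λ (j : Fin d) →
                    w ≡ 2 + toℕ y × q ≡ a i′ × (suc (toℕ i) , s) ≡ (suc (toℕ i′) , suc (toℕ j))) →
                 SameBlock (π (fsuc i)) (p i) z
    fromVertex e∈ (inj₁ z≡w) (y , _ , _ , refl , _) =
      Label.p∼new i (subst (NewAt i) (sym (numbers-injective {y = fsuc y} z≡w)) (entry-new e∈))
    fromVertex e∈ (inj₂ z≡q) (_ , i′ , _ , _ , q≡ , l≡) =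
      cong (π (fsuc i)) (numbers-injective (sym (trans z≡q (trans q≡ (trans (cong a i′≡i) (Label.label≡ i))))))
      where
      i′≡i : i′ ≡ i
      i′≡i = numbers-injective (sym (cong proj₁ l≡))

  -- A changed block either has a new minimum, which is a child of step `i`, or is the first block,
  -- which contains the common parent.
  changed⇒merged : ∀ i x → Changed (π (inject₁ i)) (π (fsuc i)) x → InMerged i x
  changed⇒merged i x xchg = byBlock (Label.new-or-first i xchg)
    where
    byBlock : (∃ λ b → NewAt i b × SameBlock (π (inject₁ i)) x b × toℕ b ≤ toℕ x) ⊎ SameBlock (π (inject₁ i)) x (m₁ i) → InMerged i x
    byBlock (inj₁ (fzero , (_ , ¬min) , _)) = contradiction (λ _ _ → z≤n) ¬min
    byBlock (inj₁ (fsuc y , ynew , x∼y , _)) = fsuc y , x∼y , _ , _ , _ , proj₂ (new-entry ynew) , inj₁ refl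
    byBlock (inj₂ x∼m₁) = p i , trans x∼m₁ (Label.m₁∼p i) , _ , _ , _ , proj₂ (a-entry i) , inj₂ (sym (Label.label≡ i))

  sameBlock-suc⇒ : ∀ i x y → SameBlock (π (fsuc i)) x y → SameBlock (π (inject₁ i)) x y ⊎ (InMerged i x × InMerged i y)
  sameBlock-suc⇒ i x y x∼y = byOld (π (inject₁ i) x ≟ π (inject₁ i) y)
    where
    byOld : Dec (SameBlock (π (inject₁ i)) x y) → SameBlock (π (inject₁ i)) x y ⊎ (InMerged i x × InMerged i y)
    byOld (yes x∼₀y) = inj₁ x∼₀y
    byOld (no x≁y) = inj₂ (changed⇒merged i x (y , x∼y , x≁y) , changed⇒merged i y (x , sym x∼y , x≁y ∘ sym))

  ⇒sameBlock-suc : ∀ i x y → SameBlock (π (inject₁ i)) x y ⊎ (InMerged i x × InMerged i y) → SameBlock (π (fsuc i)) x y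
  ⇒sameBlock-suc i x y (inj₁ x∼y) = proj₁ (proj₂ (proj₂ (proj₂ (proj₂ (proj₂ chain)) i))) x y x∼y
  ⇒sameBlock-suc i x y (inj₂ (xm , ym)) = trans (sym (merged⇒p∼ i x xm)) (merged⇒p∼ i y ym)

theorem8p11 : (d k : ℕ) → 1 ≤ d →
    (π : Fin (suc k) → Partition (suc (d * k))) → MaximalChainNCd d k π →
    (F : List PTree) → IsParkingTree d k F →
    (∀ (i : Fin k) → ∃ λ p →
    AEntry F (suc (toℕ i)) p × IsLabel (π (inject₁ i)) (π (fsuc i)) p) →
    (∀ (i : Fin (suc k)) (x y : Fin (suc (d * k))) →
    SameBlock (π i) x y ⇔ Connected F (toℕ i) (suc (toℕ x)) (suc (toℕ y)))
    ×
    (∀ (i : Fin k) (x y : Fin (suc (d * k))) →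
    SameBlock (π (fsuc i)) x y ⇔
    (SameBlock (π (inject₁ i)) x y ⊎
    (InMergedBlocks (π (inject₁ i)) F (suc (toℕ i)) x ×
    InMergedBlocks (π (inject₁ i)) F (suc (toℕ i)) y)))
theorem8p11 d k _ π chain F tree labels =
  (λ i x y → mk⇔ (sameBlock⇒connected i x y) (connected⇒sameBlock i x y)) ,
  (λ i x y → mk⇔ (sameBlock-suc⇒ i x y) (⇒sameBlock-suc i x y))
  where open ChainFromTree π chain tree (λ i → proj₁ (proj₂ (labels i))) (λ i → proj₂ (proj₂ (labels i)))
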